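{- For all integers $n \geq 0$ and all real $x$, $$c_{n+1}(x) = -(n+x)c_n(x) +(-1)^{n+1} n! \sum_{m=0}^n \frac{\widehat{c}_{m+1}}{m!}\binom{x+n}{n-m}$$ and $$\widehat{c}_{n+1}(x) = (x-n)\widehat{c}_n(x) - n! \sum_{m=0}^n \frac{(-1)^m \, c_{m+1}}{m!}\binom{x-m-1}{n-m}.$$
   Context: For real $z$ and integer $n\ge 0$, $\binom{z}{n} = \frac{z(z-1)\cdots(z-n+1)}{n!}$ (with $\binom{z}{0}=1$). The Cauchy polynomials of the first and second kind are $c_n(x) = n! \int_{0}^{1} \binom{t - x}{n}\, dt$ and $\widehat{c}_n(x) = n! \int_{0}^{1} \binom{x - t}{n}\, dt$, $n \ge 0$; the Cauchy numbers are $c_n = c_n(0)$ and $\widehat{c}_n=\widehat{c}_n(0)$. -}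

module Defs where

open import Level using (0ℓ)
open import Data.Nat.Base as ℕ using (ℕ; zero; suc; _!)
import Data.Nat.Properties as ℕ
open import Data.Integer.Base as ℤ using (+_)
open import Data.Rational.Base as ℚ using (ℚ; 0ℚ; 1ℚ; ½)
import Data.Rational.Properties as ℚ
open import Data.Rational.Solver using (module +-*-Solver)
open import Data.Fin.Base using (Fin; zero; suc; inject₁; fromℕ; toℕ)
open import Data.Product using (Σ; ∃; _×_; _,_; proj₁; proj₂)
open import Data.Sum using (inj₁; inj₂)
open import Function using (_∘_)
open import Relation.Binary using (IsEquivalence; Poset)
open import Relation.Binary.PropositionalEquality as ≡ using (_≡_; refl)
open import Algebra.Bundles using (CommutativeRing)
import Data.Fin.Properties as Fin
open import Data.Nat.Coprimality using (1-coprimeTo)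
import Data.Integer.Properties as ℤ
import Data.Rational.Unnormalised.Base as ℚᵘ
import Data.Rational.Unnormalised.Properties as ℚᵘ
import Algebra.Properties.Semiring.Sum
import Algebra.Properties.Semiring.Exp

module Estimates where

  pos : ∀ {p} → 0ℚ ℚ.< p → ℚ.Positive p
  pos = ℚ.positive

  ≤-via : ∀ {p q p′ q′} → p ≡ p′ → q ≡ q′ → p′ ℚ.≤ q′ → p ℚ.≤ q
  ≤-via refl refl p≤q = p≤q

  1>0 : 0ℚ ℚ.< 1ℚ
  1>0 = ℚ.positive⁻¹ 1ℚ

  halve : ∀ ε → 0ℚ ℚ.< ε → ∃ λ δ → 0ℚ ℚ.< δ × δ ℚ.+ δ ≡ ε
  halve ε 0<ε = ½ ℚ.* ε
    , ℚ.positive⁻¹ _ {{ℚ.pos*pos⇒pos ½ ε {{pos 0<ε}}}}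
    , solve 1 (λ e → con ½ :* e :+ con ½ :* e := e) refl ε
    where open +-*-Solver

  quotient : ∀ B ε → 0ℚ ℚ.< B → 0ℚ ℚ.< ε → ∃ λ δ → 0ℚ ℚ.< δ × B ℚ.* δ ≡ ε
  quotient B ε 0<B 0<ε = B⁻¹ ℚ.* ε
    , ℚ.positive⁻¹ _ {{ℚ.pos*pos⇒pos B⁻¹ {{ℚ.1/pos⇒pos B {{pos 0<B}}}} ε {{pos 0<ε}}}}
    , (begin
        B ℚ.* (B⁻¹ ℚ.* ε)  ≡⟨ ≡.sym (ℚ.*-assoc B B⁻¹ ε) ⟩
        B ℚ.* B⁻¹ ℚ.* ε    ≡⟨ ≡.cong (ℚ._* ε) (ℚ.*-inverseʳ B {{nz}}) ⟩
        1ℚ ℚ.* ε           ≡⟨ ℚ.*-identityˡ ε ⟩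
        ε                  ∎)
    where
    open ≡.≡-Reasoning
    nz : ℚ.NonZero B
    nz = ℚ.pos⇒nonZero B {{pos 0<B}}
    B⁻¹ : ℚ
    B⁻¹ = (ℚ.1/ B) {{nz}}

  common : ∀ {p q} → 0ℚ ℚ.< p → 0ℚ ℚ.< q → ∃ λ δ → 0ℚ ℚ.< δ × δ ℚ.≤ p × δ ℚ.≤ q
  common {p} {q} 0<p 0<q with ℚ.≤-total p q
  ... | inj₁ p≤q = p , 0<p , ℚ.≤-refl , p≤q
  ... | inj₂ q≤p = q , 0<q , q≤p , ℚ.≤-refl

  *-mono-nonNeg : ∀ {p q r s} → 0ℚ ℚ.≤ p → 0ℚ ℚ.≤ s → p ℚ.≤ q → r ℚ.≤ s →
                  p ℚ.* r ℚ.≤ q ℚ.* s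
  *-mono-nonNeg {p} {q} {r} {s} 0≤p 0≤s p≤q r≤s = ℚ.≤-trans
    (ℚ.*-monoˡ-≤-nonNeg p {{ℚ.nonNegative 0≤p}} r≤s)
    (ℚ.*-monoʳ-≤-nonNeg s {{ℚ.nonNegative 0≤s}} p≤q)

  p≤∣p∣ : ∀ p → p ℚ.≤ ℚ.∣ p ∣
  p≤∣p∣ p with ℚ.≤-total 0ℚ p
  ... | inj₁ 0≤p = ℚ.≤-reflexive (≡.sym (ℚ.0≤p⇒∣p∣≡p 0≤p))
  ... | inj₂ p≤0 = ℚ.≤-trans p≤0 (ℚ.0≤∣p∣ p)

  ∣∣-intro : ∀ p {q} → p ℚ.≤ q → ℚ.- p ℚ.≤ q → ℚ.∣ p ∣ ℚ.≤ q
  ∣∣-intro p p≤q -p≤q with ℚ.∣p∣≡p∨∣p∣≡-p p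
  ... | inj₁ eq = ≤-via eq refl p≤q
  ... | inj₂ eq = ≤-via eq refl -p≤q

  ∣∣-swap : ∀ p q → ℚ.∣ p ℚ.- q ∣ ≡ ℚ.∣ q ℚ.- p ∣
  ∣∣-swap p q = ≡.trans (≡.sym (ℚ.∣-p∣≡∣p∣ (p ℚ.- q)))
    (≡.cong ℚ.∣_∣ (solve 2 (λ p q → :- (p :- q) := q :- p) refl p q))
    where open +-*-Solver

  ∣∣-zero : ∀ p → ℚ.∣ p ℚ.- p ∣ ≡ 0ℚ
  ∣∣-zero p = ≡.cong ℚ.∣_∣ (ℚ.+-inverseʳ p)

  ∣∣-triangle : ∀ p q r → ℚ.∣ p ℚ.- r ∣ ℚ.≤ ℚ.∣ p ℚ.- q ∣ ℚ.+ ℚ.∣ q ℚ.- r ∣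
  ∣∣-triangle p q r = ≤-via
    (≡.cong ℚ.∣_∣ (solve 3 (λ p q r → p :- r := (p :- q) :+ (q :- r)) refl p q r)) refl
    (ℚ.∣p+q∣≤∣p∣+∣q∣ (p ℚ.- q) (q ℚ.- r))
    where open +-*-Solver

  +-close : ∀ p q r s → ℚ.∣ (p ℚ.+ q) ℚ.- (r ℚ.+ s) ∣ ℚ.≤ ℚ.∣ p ℚ.- r ∣ ℚ.+ ℚ.∣ q ℚ.- s ∣
  +-close p q r s = ≤-via
    (≡.cong ℚ.∣_∣ (solve 4 (λ p q r s → (p :+ q) :- (r :+ s) := (p :- r) :+ (q :- s)) refl p q r s))
    refl (ℚ.∣p+q∣≤∣p∣+∣q∣ (p ℚ.- r) (q ℚ.- s))
    where open +-*-Solver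

  -‿close : ∀ p q → ℚ.∣ (ℚ.- p) ℚ.- (ℚ.- q) ∣ ≡ ℚ.∣ p ℚ.- q ∣
  -‿close p q = ≡.trans (≡.cong ℚ.∣_∣ (solve 2 (λ p q → (:- p) :- (:- q) := q :- p) refl p q))
    (∣∣-swap q p)
    where open +-*-Solver

  *-close : ∀ p q r s → ℚ.∣ p ℚ.* q ℚ.- r ℚ.* s ∣ ℚ.≤
            ℚ.∣ p ∣ ℚ.* ℚ.∣ q ℚ.- s ∣ ℚ.+ ℚ.∣ s ∣ ℚ.* ℚ.∣ p ℚ.- r ∣
  *-close p q r s = ≤-via
    (≡.cong ℚ.∣_∣ (solve 4 (λ p q r s → p :* q :- r :* s := p :* (q :- s) :+ s :* (p :- r)) refl p q r s))
    (≡.sym (≡.cong₂ ℚ._+_ (ℚ.∣p*q∣≡∣p∣*∣q∣ p (q ℚ.- s)) (ℚ.∣p*q∣≡∣p∣*∣q∣ s (p ℚ.- r))))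
    (ℚ.∣p+q∣≤∣p∣+∣q∣ (p ℚ.* (q ℚ.- s)) (s ℚ.* (p ℚ.- r)))
    where open +-*-Solver

  scaled : ∀ {B δ ε p q} → B ℚ.* δ ≡ ε → 0ℚ ℚ.< δ → ℚ.∣ p ∣ ℚ.≤ B → ℚ.∣ q ∣ ℚ.≤ δ →
           ℚ.∣ p ∣ ℚ.* ℚ.∣ q ∣ ℚ.≤ ε
  scaled {p = p} Bδ≡ε 0<δ p≤B q≤δ =
    ≤-via refl (≡.sym Bδ≡ε) (*-mono-nonNeg (ℚ.0≤∣p∣ p) (ℚ.<⇒≤ 0<δ) p≤B q≤δ)

  ∣∣-step : ∀ p q {r} → ℚ.∣ q ℚ.- p ∣ ℚ.≤ r → ℚ.∣ q ∣ ℚ.≤ ℚ.∣ p ∣ ℚ.+ r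
  ∣∣-step p q h = ℚ.≤-trans
    (≤-via (≡.cong ℚ.∣_∣ (solve 2 (λ p q → q := p :+ (q :- p)) refl p q)) refl
      (ℚ.∣p+q∣≤∣p∣+∣q∣ p (q ℚ.- p)))
    (ℚ.+-monoʳ-≤ ℚ.∣ p ∣ h)
    where open +-*-Solver

  shift : ∀ p q → p ℚ.≤ q ℚ.+ ℚ.∣ p ℚ.- q ∣
  shift p q = ≤-via (solve 2 (λ p q → p := q :+ (p :- q)) refl p q) refl
    (ℚ.+-monoʳ-≤ q (p≤∣p∣ (p ℚ.- q)))
    where open +-*-Solver

  ∣∣-lipschitz : ∀ p q → ℚ.∣ ℚ.∣ p ∣ ℚ.- ℚ.∣ q ∣ ∣ ℚ.≤ ℚ.∣ p ℚ.- q ∣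
  ∣∣-lipschitz p q = ∣∣-intro _ (half p q)
    (≤-via (solve 2 (λ a b → :- (a :- b) := b :- a) refl ℚ.∣ p ∣ ℚ.∣ q ∣) (∣∣-swap p q) (half q p))
    where
    open +-*-Solver
    half : ∀ p q → ℚ.∣ p ∣ ℚ.- ℚ.∣ q ∣ ℚ.≤ ℚ.∣ p ℚ.- q ∣
    half p q = ≤-via refl
      (solve 2 (λ a b → a := (a :+ b) :- b) refl ℚ.∣ p ℚ.- q ∣ ℚ.∣ q ∣)
      (ℚ.+-monoˡ-≤ (ℚ.- ℚ.∣ q ∣) (≤-via
        (≡.cong ℚ.∣_∣ (solve 2 (λ p q → p := (p :- q) :+ q) refl p q)) refl
        (ℚ.∣p+q∣≤∣p∣+∣q∣ (p ℚ.- q) q)))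

  ∣∣-close : ∀ p q {r} → p ℚ.≤ q ℚ.+ r → q ℚ.≤ p ℚ.+ r → ℚ.∣ p ℚ.- q ∣ ℚ.≤ r
  ∣∣-close p q {r} p≤q+r q≤p+r = ∣∣-intro (p ℚ.- q)
    (≤-via refl (solve 2 (λ q r → r := (q :+ r) :- q) refl q r) (ℚ.+-monoˡ-≤ (ℚ.- q) p≤q+r))
    (≤-via (solve 2 (λ p q → :- (p :- q) := q :- p) refl p q)
      (solve 2 (λ q r → r := (q :+ r) :- q) refl p r) (ℚ.+-monoˡ-≤ (ℚ.- p) q≤p+r))
    where open +-*-Solver

  interchange : ∀ p q δ → (p ℚ.+ q) ℚ.+ (δ ℚ.+ δ) ≡ (p ℚ.+ δ) ℚ.+ (q ℚ.+ δ)
  interchange = solve 3 (λ p q δ → (p :+ q) :+ (δ :+ δ) := (p :+ δ) :+ (q :+ δ)) refl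
    where open +-*-Solver

  neg-shift : ∀ p q {r} → p ℚ.≤ q ℚ.+ r → ℚ.- q ℚ.≤ ℚ.- p ℚ.+ r
  neg-shift p q {r} p≤q+r = ≤-via
    (solve 2 (λ p q → :- q := p :+ (:- p :- q)) refl p q)
    (solve 3 (λ p q r → :- p :+ r := (q :+ r) :+ (:- p :- q)) refl p q r)
    (ℚ.+-monoˡ-≤ (ℚ.- p ℚ.- q) p≤q+r)
    where open +-*-Solver

  add-sub : ∀ p q → q ≡ p ℚ.+ (q ℚ.- p)
  add-sub = solve 2 (λ p q → q := p :+ (q :- p)) refl
    where open +-*-Solver

  neg≤ : ∀ p {r} → 0ℚ ℚ.≤ p ℚ.+ r → ℚ.- p ℚ.≤ r
  neg≤ p {r} h = ≤-via (≡.sym (ℚ.+-identityˡ (ℚ.- p)))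
    (solve 2 (λ p r → r := (p :+ r) :- p) refl p r) (ℚ.+-monoˡ-≤ (ℚ.- p) h)
    where open +-*-Solver

  ∣∣-small : ∀ p {r} → p ℚ.≤ 0ℚ → 0ℚ ℚ.≤ p ℚ.+ r → ℚ.∣ p ∣ ℚ.≤ r
  ∣∣-small p p≤0 h = ∣∣-intro p
    (ℚ.≤-trans p≤0 (ℚ.≤-trans (ℚ.neg-antimono-≤ p≤0) (neg≤ p h))) (neg≤ p h)

  0≤-abs : ∀ p {r} → ℚ.∣ p ∣ ℚ.≤ r → 0ℚ ℚ.≤ p ℚ.+ r
  0≤-abs p h = ≤-via (≡.sym (ℚ.+-inverseʳ p)) refl
    (ℚ.+-monoʳ-≤ p (ℚ.≤-trans (≤-via (≡.refl) (≡.sym (ℚ.∣-p∣≡∣p∣ p)) (p≤∣p∣ (ℚ.- p))) h))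

  product-bound : ∀ p q {A B α β ε} → 0ℚ ℚ.< ε → A ℚ.* α ≡ ε → B ℚ.* β ≡ ε →
    0ℚ ℚ.< α → 0ℚ ℚ.< β → ℚ.∣ p ∣ ℚ.≤ A → ℚ.∣ q ∣ ℚ.≤ B →
    0ℚ ℚ.≤ p ℚ.+ β → 0ℚ ℚ.≤ q ℚ.+ α → 0ℚ ℚ.≤ p ℚ.* q ℚ.+ ε
  product-bound p q {A} {B} {α} {β} {ε} 0<ε Aα≡ε Bβ≡ε 0<α 0<β p≤A q≤B 0≤p+β 0≤q+α
    with ℚ.≤-total 0ℚ p | ℚ.≤-total 0ℚ q
  ... | inj₁ 0≤p | inj₁ 0≤q = ≤-via (≡.sym (ℚ.+-identityʳ 0ℚ)) refl (ℚ.+-mono-≤ 0≤pq (ℚ.<⇒≤ 0<ε))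
    where
    0≤pq : 0ℚ ℚ.≤ p ℚ.* q
    0≤pq = ℚ.nonNegative⁻¹ (p ℚ.* q)
      {{ℚ.nonNeg*nonNeg⇒nonNeg p {{ℚ.nonNegative 0≤p}} q {{ℚ.nonNegative 0≤q}}}}
  ... | inj₂ p≤0 | _ = 0≤-abs (p ℚ.* q) (≤-via
          (≡.trans (≡.cong ℚ.∣_∣ (ℚ.*-comm p q)) (ℚ.∣p*q∣≡∣p∣*∣q∣ q p)) refl
          (scaled Bβ≡ε 0<β q≤B (∣∣-small p p≤0 0≤p+β)))
  ... | inj₁ _ | inj₂ q≤0 = 0≤-abs (p ℚ.* q) (≤-via (ℚ.∣p*q∣≡∣p∣*∣q∣ p q) refl
          (scaled Aα≡ε 0<α p≤A (∣∣-small q q≤0 0≤q+α)))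

  /1-suc : ∀ n → + suc n ℚ./ 1 ≡ 1ℚ ℚ.+ (+ n ℚ./ 1)
  /1-suc n = ℚ.toℚᵘ-injective (begin
    ℚ.toℚᵘ (+ suc n ℚ./ 1)                 ≈⟨ ℚ.toℚᵘ-fromℚᵘ (ℚᵘ.mkℚᵘ (+ suc n) 0) ⟩
    ℚᵘ.mkℚᵘ (+ suc n) 0                    ≈⟨ ℚᵘ.*≡* (≡.cong (ℤ._* (+ 1)) (≡.cong (λ k → + 1 ℤ.+ k) (≡.sym (ℤ.*-identityʳ (+ n))))) ⟩
    ℚᵘ.1ℚᵘ ℚᵘ.+ ℚᵘ.mkℚᵘ (+ n) 0            ≈⟨ ℚᵘ.+-congʳ ℚᵘ.1ℚᵘ (ℚᵘ.≃-sym (ℚ.toℚᵘ-fromℚᵘ (ℚᵘ.mkℚᵘ (+ n) 0))) ⟩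
    ℚᵘ.1ℚᵘ ℚᵘ.+ ℚ.toℚᵘ (+ n ℚ./ 1)         ≈⟨ ℚᵘ.≃-sym (ℚ.toℚᵘ-homo-+ 1ℚ (+ n ℚ./ 1)) ⟩
    ℚ.toℚᵘ (1ℚ ℚ.+ (+ n ℚ./ 1))            ∎)
    where open ℚᵘ.≃-Reasoning

  unit-fraction : ∀ q → 0ℚ ℚ.< q → ∃ λ N → ∃ λ r → 0ℚ ℚ.≤ r × r ℚ.≤ q × (+ suc N ℚ./ 1) ℚ.* r ≡ 1ℚ
  unit-fraction q@(ℚ.mkℚ ℤ.+[1+ n ] d _) 0<q = d , r , ℚ.*≤* (ℤ.+≤+ ℕ.z≤n)
    , ℚ.*≤* (ℤ.*-monoʳ-≤-nonNeg (+ suc d) (ℤ.+≤+ (ℕ.s≤s (ℕ.z≤n {n}))))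
    , ℚ.toℚᵘ-injective (begin
        ℚ.toℚᵘ ((+ suc d ℚ./ 1) ℚ.* r)        ≈⟨ ℚ.toℚᵘ-homo-* (+ suc d ℚ./ 1) r ⟩
        ℚ.toℚᵘ (+ suc d ℚ./ 1) ℚᵘ.* ℚ.toℚᵘ r  ≈⟨ ℚᵘ.*-congʳ {ℚ.toℚᵘ r} (ℚ.toℚᵘ-fromℚᵘ (ℚᵘ.mkℚᵘ (+ suc d) 0)) ⟩
        ℚᵘ.mkℚᵘ (+ suc d) 0 ℚᵘ.* ℚ.toℚᵘ r     ≈⟨ ℚᵘ.*≡* (≡.trans (≡.trans (ℤ.*-identityʳ _) (ℤ.*-identityʳ (+ suc d))) (≡.sym (≡.trans (ℤ.*-identityˡ _) (≡.cong (λ k → + suc k) (ℕ.+-identityʳ d))))) ⟩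
        ℚᵘ.1ℚᵘ                                ∎)
    where
    open ℚᵘ.≃-Reasoning
    r : ℚ
    r = ℚ.mkℚ (+ 1) d (1-coprimeTo (suc d))
  unit-fraction (ℚ.mkℚ (+ 0) d _) (ℚ.*<* (ℤ.+<+ ()))
  unit-fraction (ℚ.mkℚ ℤ.-[1+ n ] d _) (ℚ.*<* ())

open Estimates

Eventually : (ℕ → Set) → Set
Eventually P = ∃ λ N → ∀ n → N ℕ.≤ n → P n

IsCauchy : (ℕ → ℚ) → Set
IsCauchy s = ∀ ε → 0ℚ ℚ.< ε →
  ∃ λ N → ∀ m n → N ℕ.≤ m → N ℕ.≤ n → ℚ.∣ s m ℚ.- s n ∣ ℚ.≤ ε

-- The modulus of convergence is part of the data, and equality of reals is
-- the relation _≈_ below, not _≡_.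

record ℝ : Set where
  no-eta-equality
  field
    seq    : ℕ → ℚ
    cauchy : IsCauchy seq

open ℝ public

infix 4 _≈_ _≤_

-- Equality and order are records, rather than functions returning a type,
-- so that their arguments can be inferred.

record _≈_ (x y : ℝ) : Set where
  constructor mk≈
  field
    close : ∀ ε → 0ℚ ℚ.< ε → Eventually λ n → ℚ.∣ seq x n ℚ.- seq y n ∣ ℚ.≤ ε

record _≤_ (x y : ℝ) : Set where
  constructor mk≤
  field
    below : ∀ ε → 0ℚ ℚ.< ε → Eventually λ n → seq x n ℚ.≤ seq y n ℚ.+ ε

open _≈_ public
open _≤_ public

both : ∀ {P Q R : ℕ → Set} → (∀ n → P n → Q n → R n) →
       Eventually P → Eventually Q → Eventually R
both f (M , p) (N , q) = M ℕ.⊔ N , λ n le →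
  f n (p n (ℕ.≤-trans (ℕ.m≤m⊔n M N) le)) (q n (ℕ.≤-trans (ℕ.m≤n⊔m M N) le))

weaken : ∀ {P Q : ℕ → Set} → (∀ n → P n → Q n) → Eventually P → Eventually Q
weaken f (N , p) = N , λ n le → f n (p n le)

bounded : ∀ x → ∃ λ B → 0ℚ ℚ.< B × Eventually λ n → ℚ.∣ seq x n ∣ ℚ.≤ B
bounded x =
  let N , h = cauchy x 1ℚ 1>0
  in ℚ.∣ seq x N ∣ ℚ.+ 1ℚ
    , ℚ.positive⁻¹ _ {{ℚ.nonNeg+pos⇒pos ℚ.∣ seq x N ∣ {{ℚ.∣-∣-nonNeg (seq x N)}} 1ℚ}}
    , N , λ n N≤n → ∣∣-step (seq x N) (seq x n) (h n N N≤n ℕ.≤-refl)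

fromℚ : ℚ → ℝ
seq    (fromℚ p) _ = p
cauchy (fromℚ p) ε 0<ε = 0 , λ _ _ _ _ → ≤-via (∣∣-zero p) refl (ℚ.<⇒≤ 0<ε)

infixl 6 _+_ _-_
infixl 7 _*_
infix  8 -_

_+_ : ℝ → ℝ → ℝ
seq    (x + y) n = seq x n ℚ.+ seq y n
cauchy (x + y) ε 0<ε =
  let δ , 0<δ , δ+δ≡ε = halve ε 0<ε
      M , p = cauchy x δ 0<δ
      N , q = cauchy y δ 0<δ
  in M ℕ.⊔ N , λ m n le le′ → ℚ.≤-trans
    (+-close (seq x m) (seq y m) (seq x n) (seq y n))
    (≤-via refl (≡.sym δ+δ≡ε) (ℚ.+-mono-≤
      (p m n (ℕ.≤-trans (ℕ.m≤m⊔n M N) le) (ℕ.≤-trans (ℕ.m≤m⊔n M N) le′))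
      (q m n (ℕ.≤-trans (ℕ.m≤n⊔m M N) le) (ℕ.≤-trans (ℕ.m≤n⊔m M N) le′))))

-_ : ℝ → ℝ
seq    (- x) n = ℚ.- seq x n
cauchy (- x) ε 0<ε =
  let N , p = cauchy x ε 0<ε
  in N , λ m n le le′ → ≤-via (-‿close (seq x m) (seq x n)) refl (p m n le le′)

_*_ : ℝ → ℝ → ℝ
seq    (x * y) n = seq x n ℚ.* seq y n
cauchy (x * y) ε 0<ε =
  let δ , 0<δ , δ+δ≡ε = halve ε 0<ε
      A , 0<A , K , a = bounded x
      B , 0<B , L , b = bounded y
      α , 0<α , Aα≡δ = quotient A δ 0<A 0<δ
      β , 0<β , Bβ≡δ = quotient B δ 0<B 0<δ
      M , p = cauchy y α 0<α
      N , q = cauchy x β 0<β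
      K≤ = ℕ.≤-trans (ℕ.m≤m⊔n K L) (ℕ.m≤m⊔n (K ℕ.⊔ L) (M ℕ.⊔ N))
      L≤ = ℕ.≤-trans (ℕ.m≤n⊔m K L) (ℕ.m≤m⊔n (K ℕ.⊔ L) (M ℕ.⊔ N))
      M≤ = ℕ.≤-trans (ℕ.m≤m⊔n M N) (ℕ.m≤n⊔m (K ℕ.⊔ L) (M ℕ.⊔ N))
      N≤ = ℕ.≤-trans (ℕ.m≤n⊔m M N) (ℕ.m≤n⊔m (K ℕ.⊔ L) (M ℕ.⊔ N))
  in (K ℕ.⊔ L) ℕ.⊔ (M ℕ.⊔ N) , λ m n le le′ → ℚ.≤-trans
    (*-close (seq x m) (seq y m) (seq x n) (seq y n))
    (≤-via refl (≡.sym δ+δ≡ε) (ℚ.+-mono-≤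
      (scaled Aα≡δ 0<α (a m (ℕ.≤-trans K≤ le)) (p m n (ℕ.≤-trans M≤ le) (ℕ.≤-trans M≤ le′)))
      (scaled Bβ≡δ 0<β (b n (ℕ.≤-trans L≤ le′)) (q m n (ℕ.≤-trans N≤ le) (ℕ.≤-trans N≤ le′)))))

∣_∣ : ℝ → ℝ
seq    ∣ x ∣ n = ℚ.∣ seq x n ∣
cauchy ∣ x ∣ ε 0<ε =
  let N , p = cauchy x ε 0<ε
  in N , λ m n le le′ → ℚ.≤-trans (∣∣-lipschitz (seq x m) (seq x n)) (p m n le le′)

0ℝ 1ℝ : ℝ
0ℝ = fromℚ 0ℚ
1ℝ = fromℚ 1ℚ

_-_ : ℝ → ℝ → ℝ
x - y = x + (- y)

fromNat : ℕ → ℝ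
fromNat n = fromℚ (+ n ℚ./ 1)

pointwise : ∀ {x y} → (∀ n → seq x n ≡ seq y n) → x ≈ y
close (pointwise {x} {y} eq) ε 0<ε = 0 , λ n _ →
  ≤-via (≡.trans (≡.cong (λ p → ℚ.∣ p ℚ.- seq y n ∣) (eq n)) (∣∣-zero (seq y n))) refl (ℚ.<⇒≤ 0<ε)

pointwise-≤ : ∀ {x y} → (∀ n → seq x n ℚ.≤ seq y n) → x ≤ y
below (pointwise-≤ {x} {y} le) ε 0<ε = 0 , λ n _ →
  ≤-via (≡.sym (ℚ.+-identityʳ _)) refl (ℚ.+-mono-≤ (le n) (ℚ.<⇒≤ 0<ε))

≈-isEquivalence : IsEquivalence _≈_
≈-isEquivalence = record { refl = pointwise λ _ → refl ; sym = ≈-sym ; trans = ≈-trans }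
  where
  ≈-sym : ∀ {x y} → x ≈ y → y ≈ x
  close (≈-sym {x} {y} x≈y) ε 0<ε =
    weaken (λ n → ≤-via (∣∣-swap (seq y n) (seq x n)) refl) (close x≈y ε 0<ε)
  ≈-trans : ∀ {x y z} → x ≈ y → y ≈ z → x ≈ z
  close (≈-trans {x} {y} {z} x≈y y≈z) ε 0<ε =
    let δ , 0<δ , δ+δ≡ε = halve ε 0<ε
    in both
      (λ n p q → ℚ.≤-trans (∣∣-triangle (seq x n) (seq y n) (seq z n))
        (≤-via refl (≡.sym δ+δ≡ε) (ℚ.+-mono-≤ p q)))
      (close x≈y δ 0<δ) (close y≈z δ 0<δ)

+-cong : ∀ {x y u v} → x ≈ y → u ≈ v → x + u ≈ y + v
close (+-cong {x} {y} {u} {v} x≈y u≈v) ε 0<ε =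
  let δ , 0<δ , δ+δ≡ε = halve ε 0<ε
  in both
    (λ n p q → ℚ.≤-trans (+-close (seq x n) (seq u n) (seq y n) (seq v n))
      (≤-via refl (≡.sym δ+δ≡ε) (ℚ.+-mono-≤ p q)))
    (close x≈y δ 0<δ) (close u≈v δ 0<δ)

-‿cong : ∀ {x y} → x ≈ y → - x ≈ - y
close (-‿cong {x} {y} x≈y) ε 0<ε =
  weaken (λ n → ≤-via (-‿close (seq x n) (seq y n)) refl) (close x≈y ε 0<ε)

*-cong : ∀ {x y u v} → x ≈ y → u ≈ v → x * u ≈ y * v
close (*-cong {x} {y} {u} {v} x≈y u≈v) ε 0<ε =
  let δ , 0<δ , δ+δ≡ε = halve ε 0<ε
      A , 0<A , a = bounded x
      B , 0<B , b = bounded v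
      α , 0<α , Aα≡δ = quotient A δ 0<A 0<δ
      β , 0<β , Bβ≡δ = quotient B δ 0<B 0<δ
  in both
    (λ n p q → ℚ.≤-trans (*-close (seq x n) (seq u n) (seq y n) (seq v n))
      (≤-via refl (≡.sym δ+δ≡ε) (ℚ.+-mono-≤ p q)))
    (both (λ n → scaled Aα≡δ 0<α) a (close u≈v α 0<α))
    (both (λ n → scaled Bβ≡δ 0<β) b (close x≈y β 0<β))

ℝ-commutativeRing : CommutativeRing 0ℓ 0ℓ
ℝ-commutativeRing = record
  { Carrier = ℝ ; _≈_ = _≈_ ; _+_ = _+_ ; _*_ = _*_ ; -_ = -_ ; 0# = 0ℝ ; 1# = 1ℝ
  ; isCommutativeRing = record
    { isRing = record
      { +-isAbelianGroup = record
        { isGroup = record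
          { isMonoid = record
            { isSemigroup = record
              { isMagma = record { isEquivalence = ≈-isEquivalence ; ∙-cong = +-cong }
              ; assoc = λ x y z → pointwise λ n → ℚ.+-assoc (seq x n) (seq y n) (seq z n)
              }
            ; identity = (λ x → pointwise λ n → ℚ.+-identityˡ (seq x n))
                       , (λ x → pointwise λ n → ℚ.+-identityʳ (seq x n))
            }
          ; inverse = (λ x → pointwise λ n → ℚ.+-inverseˡ (seq x n))
                    , (λ x → pointwise λ n → ℚ.+-inverseʳ (seq x n))
          ; ⁻¹-cong = -‿cong
          }
        ; comm = λ x y → pointwise λ n → ℚ.+-comm (seq x n) (seq y n)
        }
      ; *-cong = *-cong
      ; *-assoc = λ x y z → pointwise λ n → ℚ.*-assoc (seq x n) (seq y n) (seq z n)
      ; *-identity = (λ x → pointwise λ n → ℚ.*-identityˡ (seq x n))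
                   , (λ x → pointwise λ n → ℚ.*-identityʳ (seq x n))
      ; distrib = (λ x y z → pointwise λ n → ℚ.*-distribˡ-+ (seq x n) (seq y n) (seq z n))
                , (λ x y z → pointwise λ n → ℚ.*-distribʳ-+ (seq x n) (seq y n) (seq z n))
      }
    ; *-comm = λ x y → pointwise λ n → ℚ.*-comm (seq x n) (seq y n)
    }
  }

≤-reflexive : ∀ {x y} → x ≈ y → x ≤ y
below (≤-reflexive {x} {y} x≈y) ε 0<ε = weaken
  (λ n p → ℚ.≤-trans (shift (seq x n) (seq y n)) (ℚ.+-monoʳ-≤ (seq y n) p)) (close x≈y ε 0<ε)

≤-trans : ∀ {x y z} → x ≤ y → y ≤ z → x ≤ z
below (≤-trans {x} {y} {z} x≤y y≤z) ε 0<ε =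
  let δ , 0<δ , δ+δ≡ε = halve ε 0<ε
  in both
    (λ n p q → ℚ.≤-trans p (≤-via refl
      (≡.trans (≡.cong (seq z n ℚ.+_) (≡.sym δ+δ≡ε)) (≡.sym (ℚ.+-assoc (seq z n) δ δ)))
      (ℚ.+-monoˡ-≤ δ q)))
    (below x≤y δ 0<δ) (below y≤z δ 0<δ)

≤-antisym : ∀ {x y} → x ≤ y → y ≤ x → x ≈ y
close (≤-antisym {x} {y} x≤y y≤x) ε 0<ε = both
  (λ n p q → ∣∣-close (seq x n) (seq y n) p q) (below x≤y ε 0<ε) (below y≤x ε 0<ε)

≤-poset : Poset 0ℓ 0ℓ 0ℓ
≤-poset = record
  { Carrier = ℝ ; _≈_ = _≈_ ; _≤_ = _≤_
  ; isPartialOrder = record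
    { isPreorder = record
      { isEquivalence = ≈-isEquivalence ; reflexive = ≤-reflexive ; trans = ≤-trans }
    ; antisym = ≤-antisym
    }
  }

open CommutativeRing ℝ-commutativeRing public using (semiring)
  renaming (refl to ≈-refl; sym to ≈-sym; trans to ≈-trans)

≤-refl : ∀ {x} → x ≤ x
≤-refl = ≤-reflexive ≈-refl

≤-resp : ∀ {x x′ y y′} → x ≈ x′ → y ≈ y′ → x′ ≤ y′ → x ≤ y
≤-resp x≈x′ y≈y′ x′≤y′ = ≤-trans (≤-reflexive x≈x′) (≤-trans x′≤y′ (≤-reflexive (≈-sym y≈y′)))

+-mono-≤ : ∀ {x y u v} → x ≤ y → u ≤ v → x + u ≤ y + v
below (+-mono-≤ {x} {y} {u} {v} x≤y u≤v) ε 0<ε =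
  let δ , 0<δ , δ+δ≡ε = halve ε 0<ε
  in both
    (λ n p q → ≤-via refl
      (≡.trans (≡.cong ((seq y n ℚ.+ seq v n) ℚ.+_) (≡.sym δ+δ≡ε))
        (interchange (seq y n) (seq v n) δ))
      (ℚ.+-mono-≤ p q))
    (below x≤y δ 0<δ) (below u≤v δ 0<δ)

-‿anti-≤ : ∀ {x y} → x ≤ y → - y ≤ - x
below (-‿anti-≤ {x} {y} x≤y) ε 0<ε = weaken (λ n → neg-shift (seq x n) (seq y n)) (below x≤y ε 0<ε)

x≤y⇒0≤y-x : ∀ {x y} → x ≤ y → 0ℝ ≤ y - x
x≤y⇒0≤y-x {x} {y} x≤y = ≤-resp (≈-sym (-‿inverseʳ x)) ≈-refl (+-mono-≤ x≤y ≤-refl)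
  where open CommutativeRing ℝ-commutativeRing using (-‿inverseʳ)

0≤y-x⇒x≤y : ∀ {x y} → 0ℝ ≤ y - x → x ≤ y
0≤y-x⇒x≤y {x} {y} 0≤y-x = ≤-resp
  (pointwise λ n → ≡.sym (ℚ.+-identityʳ (seq x n)))
  (pointwise λ n → add-sub (seq x n) (seq y n))
  (+-mono-≤ (≤-refl {x}) 0≤y-x)

*-nonNeg : ∀ {x y} → 0ℝ ≤ x → 0ℝ ≤ y → 0ℝ ≤ x * y
below (*-nonNeg {x} {y} 0≤x 0≤y) ε 0<ε =
  let A , 0<A , a = bounded x
      B , 0<B , b = bounded y
      α , 0<α , Aα≡ε = quotient A ε 0<A 0<ε
      β , 0<β , Bβ≡ε = quotient B ε 0<B 0<ε
      δ , 0<δ , δ≤α , δ≤β = common 0<α 0<β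
  in both (λ n f p → f p)
    (both (λ n (p , q) r s → product-bound (seq x n) (seq y n) 0<ε Aα≡ε Bβ≡ε 0<α 0<β p q
             (ℚ.≤-trans r (ℚ.+-monoʳ-≤ (seq x n) δ≤β)) (ℚ.≤-trans s (ℚ.+-monoʳ-≤ (seq y n) δ≤α)))
      (both (λ n → _,_) a b) (below 0≤x δ 0<δ))
    (below 0≤y δ 0<δ)

*-mono-≤ : ∀ {x y u v} → 0ℝ ≤ x → 0ℝ ≤ v → x ≤ y → u ≤ v → x * u ≤ y * v
*-mono-≤ {x} {y} {u} {v} 0≤x 0≤v x≤y u≤v = 0≤y-x⇒x≤y (≤-resp
  (pointwise λ n → refl)
  (pointwise λ n → split (seq x n) (seq y n) (seq u n) (seq v n))
  (+-mono-≤ (*-nonNeg (x≤y⇒0≤y-x x≤y) 0≤v) (*-nonNeg 0≤x (x≤y⇒0≤y-x u≤v))))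
  where
  open +-*-Solver
  split : ∀ x y u v → y ℚ.* v ℚ.- x ℚ.* u ≡ (y ℚ.- x) ℚ.* v ℚ.+ x ℚ.* (v ℚ.- u)
  split = solve 4 (λ x y u v → y :* v :- x :* u := (y :- x) :* v :+ x :* (v :- u)) refl

∣∣-cong : ∀ {x y} → x ≈ y → ∣ x ∣ ≈ ∣ y ∣
close (∣∣-cong {x} {y} x≈y) ε 0<ε =
  weaken (λ n → ℚ.≤-trans (∣∣-lipschitz (seq x n) (seq y n))) (close x≈y ε 0<ε)

∣∣-bound : ∀ {x y} → x ≤ y → - x ≤ y → ∣ x ∣ ≤ y
below (∣∣-bound {x} {y} x≤y -x≤y) ε 0<ε =
  both (λ n → ∣∣-intro (seq x n)) (below x≤y ε 0<ε) (below -x≤y ε 0<ε)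

0≤∣x∣ : ∀ x → 0ℝ ≤ ∣ x ∣
0≤∣x∣ x = pointwise-≤ λ n → ℚ.0≤∣p∣ (seq x n)

∣x+y∣≤∣x∣+∣y∣ : ∀ x y → ∣ x + y ∣ ≤ ∣ x ∣ + ∣ y ∣
∣x+y∣≤∣x∣+∣y∣ x y = pointwise-≤ λ n → ℚ.∣p+q∣≤∣p∣+∣q∣ (seq x n) (seq y n)

∣x*y∣≈∣x∣*∣y∣ : ∀ x y → ∣ x * y ∣ ≈ ∣ x ∣ * ∣ y ∣
∣x*y∣≈∣x∣*∣y∣ x y = pointwise λ n → ℚ.∣p*q∣≡∣p∣*∣q∣ (seq x n) (seq y n)

fromℚ-mono-≤ : ∀ {p q} → p ℚ.≤ q → fromℚ p ≤ fromℚ q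
fromℚ-mono-≤ p≤q = pointwise-≤ λ _ → p≤q

∣∣-bounded : ∀ x → ∃ λ B → 0ℚ ℚ.< B × ∣ x ∣ ≤ fromℚ B
∣∣-bounded x = let B , 0<B , b = bounded x in B , 0<B , mk≤ λ ε 0<ε →
  weaken (λ n p → ℚ.≤-trans p (≤-via (≡.sym (ℚ.+-identityʳ B)) refl (ℚ.+-monoʳ-≤ B (ℚ.<⇒≤ 0<ε)))) b

∣x-y∣≤ε⇒x≈y : ∀ {x y} → (∀ ε → 0ℚ ℚ.< ε → ∣ x - y ∣ ≤ fromℚ ε) → x ≈ y
close (∣x-y∣≤ε⇒x≈y h) ε 0<ε =
  let δ , 0<δ , δ+δ≡ε = halve ε 0<ε
  in weaken (λ n → ≤-via refl (≡.sym δ+δ≡ε)) (below (h δ 0<δ) δ 0<δ)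

open import Algebra.Properties.Semiring.Sum semiring public
  using (sum; sum-syntax; sum⁺-syntax)
open import Algebra.Properties.Semiring.Exp semiring public
  using (_^_)

private
  module Sum = Algebra.Properties.Semiring.Sum semiring
  module Exp = Algebra.Properties.Semiring.Exp semiring

record TaggedPartition (a b : ℝ) : Set where
  field
    size        : ℕ
    point       : Fin (suc size) → ℝ
    tag         : Fin size → ℝ
    point-first : point zero ≈ a
    point-last  : point (fromℕ size) ≈ b
    point≤tag   : ∀ i → point (inject₁ i) ≤ tag i
    tag≤point   : ∀ i → tag i ≤ point (suc i)

  width : Fin size → ℝ
  width i = point (suc i) - point (inject₁ i)

  MeshAtMost : ℚ → Set
  MeshAtMost δ = ∀ i → width i ≤ fromℚ δ

riemannSum : ∀ {a b} → (ℝ → ℝ) → TaggedPartition a b → ℝ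
riemannSum f P = ∑[ i < size ] (f (tag i) * width i)
  where open TaggedPartition P

-- The tolerance and the mesh bound range over positive rationals, which
-- suffices because every positive real exceeds one.  If b < a there are no
-- partitions, so this is meaningful only for a ≤ b.

record IsRiemannIntegral (a b : ℝ) (f : ℝ → ℝ) (I : ℝ) : Set where
  constructor mkIntegral
  field
    approximates : ∀ ε → 0ℚ ℚ.< ε → ∃ λ δ → 0ℚ ℚ.< δ ×
      (∀ (P : TaggedPartition a b) → TaggedPartition.MeshAtMost P δ →
        ∣ riemannSum f P - I ∣ ≤ fromℚ ε)

open IsRiemannIntegral public

record Integrable (a b : ℝ) (f : ℝ → ℝ) : Set where
  constructor mkIntegrable
  field
    value      : ℝ
    isIntegral : IsRiemannIntegral a b f value

-- For a ≤ b the value does not depend on the integrability proof: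
-- see isIntegral-unique.

∫ : ∀ a b f → Integrable a b f → ℝ
∫ a b f f-integrable = Integrable.value f-integrable

sum-mono-≤ : ∀ {n} {u v : Fin n → ℝ} → (∀ i → u i ≤ v i) → sum u ≤ sum v
sum-mono-≤ {zero}  u≤v = ≤-refl
sum-mono-≤ {suc n} u≤v = +-mono-≤ (u≤v zero) (sum-mono-≤ (u≤v ∘ suc))

∣sum∣≤ : ∀ {n} {u v : Fin n → ℝ} → (∀ i → ∣ u i ∣ ≤ v i) → ∣ sum u ∣ ≤ sum v
∣sum∣≤ {zero}          h = pointwise-≤ λ _ → ℚ.≤-refl
∣sum∣≤ {suc n} {u} {v} h =
  ≤-trans (∣x+y∣≤∣x∣+∣y∣ (u zero) (sum (u ∘ suc))) (+-mono-≤ (h zero) (∣sum∣≤ (h ∘ suc)))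

sum-telescope : ∀ {n} (p : Fin (suc n) → ℝ) →
  ∑[ i < n ] (p (suc i) - p (inject₁ i)) ≈ p (fromℕ n) - p zero
sum-telescope {zero}  p = ≈-sym (-‿inverseʳ (p zero))
  where open CommutativeRing ℝ-commutativeRing using (-‿inverseʳ)
sum-telescope {suc n} p = ≈-trans (+-cong ≈-refl (sum-telescope (p ∘ suc)))
  (pointwise λ k → telescope (seq (p zero) k) (seq (p (suc zero)) k) (seq (p (fromℕ (suc n))) k))
  where
  open +-*-Solver
  telescope : ∀ a b c → (b ℚ.- a) ℚ.+ (c ℚ.- b) ≡ c ℚ.- a
  telescope = solve 3 (λ a b c → (b :- a) :+ (c :- b) := c :- a) refl

x≤∣x∣ : ∀ x → x ≤ ∣ x ∣
x≤∣x∣ x = pointwise-≤ λ n → p≤∣p∣ (seq x n)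

∣∣-resp : ∀ {x x′ y} → x ≈ x′ → ∣ x′ ∣ ≤ y → ∣ x ∣ ≤ y
∣∣-resp x≈x′ = ≤-resp (∣∣-cong x≈x′) ≈-refl

∣x-z∣≤∣x-y∣+∣y-z∣ : ∀ x y z → ∣ x - z ∣ ≤ ∣ x - y ∣ + ∣ y - z ∣
∣x-z∣≤∣x-y∣+∣y-z∣ x y z = pointwise-≤ λ n → ∣∣-triangle (seq x n) (seq y n) (seq z n)

∣x-y∣≈∣y-x∣ : ∀ x y → ∣ x - y ∣ ≈ ∣ y - x ∣
∣x-y∣≈∣y-x∣ x y = pointwise λ n → ∣∣-swap (seq x n) (seq y n)

module _ {a b : ℝ} where

  open CommutativeRing ℝ-commutativeRing using (distribʳ; distribˡ; *-assoc)

  isIntegral-cong : ∀ {f g I J} → (∀ t → f t ≈ g t) → I ≈ J →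
    IsRiemannIntegral a b f I → IsRiemannIntegral a b g J
  approximates (isIntegral-cong f≈g I≈J h) ε 0<ε =
    let δ , 0<δ , hδ = approximates h ε 0<ε
    in δ , 0<δ , λ P mesh → ∣∣-resp
      (+-cong (Sum.sum-cong-≋ λ i → *-cong (≈-sym (f≈g (TaggedPartition.tag P i))) ≈-refl)
        (-‿cong (≈-sym I≈J)))
      (hδ P mesh)

  riemannSum-+ : ∀ f g (P : TaggedPartition a b) →
    riemannSum (λ t → f t + g t) P ≈ riemannSum f P + riemannSum g P
  riemannSum-+ f g P = ≈-trans
    (Sum.sum-cong-≋ λ i → distribʳ (width i) (f (tag i)) (g (tag i)))
    (Sum.∑-distrib-+ (λ i → f (tag i) * width i) (λ i → g (tag i) * width i))
    where open TaggedPartition P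

  riemannSum-* : ∀ c f (P : TaggedPartition a b) →
    riemannSum (λ t → c * f t) P ≈ c * riemannSum f P
  riemannSum-* c f P = ≈-trans
    (Sum.sum-cong-≋ λ i → *-assoc c (f (tag i)) (width i))
    (≈-sym (Sum.*-distribˡ-sum c (λ i → f (tag i) * width i)))
    where open TaggedPartition P

  isIntegral-+ : ∀ {f g I J} → IsRiemannIntegral a b f I → IsRiemannIntegral a b g J →
    IsRiemannIntegral a b (λ t → f t + g t) (I + J)
  approximates (isIntegral-+ {f} {g} {I} {J} hf hg) ε 0<ε =
    let η , 0<η , η+η≡ε = halve ε 0<ε
        α , 0<α , hα = approximates hf η 0<η
        β , 0<β , hβ = approximates hg η 0<η
        δ , 0<δ , δ≤α , δ≤β = common 0<α 0<β
    in δ , 0<δ , λ P mesh → ∣∣-resp (+-cong (riemannSum-+ f g P) ≈-refl)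
      (≤-trans
        (pointwise-≤ λ n → +-close (seq (riemannSum f P) n) (seq (riemannSum g P) n) (seq I n) (seq J n))
        (≤-resp ≈-refl (pointwise λ _ → ≡.sym η+η≡ε)
          (+-mono-≤ (hα P λ i → ≤-trans (mesh i) (fromℚ-mono-≤ δ≤α))
                    (hβ P λ i → ≤-trans (mesh i) (fromℚ-mono-≤ δ≤β)))))

  isIntegral-* : ∀ {f I} c → IsRiemannIntegral a b f I →
    IsRiemannIntegral a b (λ t → c * f t) (c * I)
  approximates (isIntegral-* {f} {I} c hf) ε 0<ε =
    let B , 0<B , c≤B = ∣∣-bounded c
        η , 0<η , Bη≡ε = quotient B ε 0<B 0<ε
        δ , 0<δ , hδ = approximates hf η 0<η
    in δ , 0<δ , λ P mesh → ∣∣-resp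
      (≈-trans (+-cong (riemannSum-* c f P) ≈-refl)
        (pointwise λ n → factor (seq c n) (seq (riemannSum f P) n) (seq I n)))
      (≤-resp (∣x*y∣≈∣x∣*∣y∣ c (riemannSum f P - I)) (pointwise λ _ → ≡.sym Bη≡ε)
        (*-mono-≤ (0≤∣x∣ c) (fromℚ-mono-≤ (ℚ.<⇒≤ 0<η)) c≤B (hδ P mesh)))
    where
    open +-*-Solver
    factor : ∀ c s i → c ℚ.* s ℚ.- c ℚ.* i ≡ c ℚ.* (s ℚ.- i)
    factor = solve 3 (λ c s i → c :* s :- c :* i := c :* (s :- i)) refl

fromℚ-1/ : ∀ q .{{_ : ℚ.NonZero q}} → fromℚ q * fromℚ (ℚ.1/ q) ≈ 1ℝ
fromℚ-1/ q = pointwise λ _ → ℚ.*-inverseʳ q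

fromNat-suc : ∀ n → fromNat (suc n) ≈ 1ℝ + fromNat n
fromNat-suc n = pointwise λ _ → /1-suc n

affine-first : ∀ a b r → a + (b - a) * (fromNat 0 * r) ≈ a
affine-first a b r = pointwise λ k → eq (seq a k) (seq b k) (seq r k)
  where
  open +-*-Solver
  eq : ∀ a b r → a ℚ.+ (b ℚ.- a) ℚ.* (0ℚ ℚ.* r) ≡ a
  eq = solve 3 (λ a b r → a :+ (b :- a) :* (con 0ℚ :* r) := a) refl

affine-last : ∀ a b {s} → s ≈ 1ℝ → a + (b - a) * s ≈ b
affine-last a b s≈1 = ≈-trans (+-cong ≈-refl (*-cong ≈-refl s≈1))
  (pointwise λ k → eq (seq a k) (seq b k))
  where
  open +-*-Solver
  eq : ∀ a b → a ℚ.+ (b ℚ.- a) ℚ.* 1ℚ ≡ b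
  eq = solve 2 (λ a b → a :+ (b :- a) :* con 1ℚ := b) refl

affine-step : ∀ a w r {s t} → s ≈ 1ℝ + t → (a + w * (s * r)) - (a + w * (t * r)) ≈ w * r
affine-step a w r {s} {t} s≈1+t = ≈-trans
  (+-cong (+-cong (≈-refl {a}) (*-cong (≈-refl {w}) (*-cong s≈1+t (≈-refl {r})))) ≈-refl)
  (pointwise λ k → eq (seq a k) (seq w k) (seq t k) (seq r k))
  where
  open +-*-Solver
  eq : ∀ a w t r → (a ℚ.+ w ℚ.* ((1ℚ ℚ.+ t) ℚ.* r)) ℚ.- (a ℚ.+ w ℚ.* (t ℚ.* r)) ≡ w ℚ.* r
  eq = solve 4 (λ a w t r → (a :+ w :* ((con 1ℚ :+ t) :* r)) :- (a :+ w :* (t :* r)) := w :* r) refl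

fromNat-cong : ∀ {m n} → m ≡ n → fromNat m ≈ fromNat n
fromNat-cong refl = ≈-refl

module Uniform {a b : ℝ} (a≤b : a ≤ b) (N : ℕ) (r : ℝ) (0≤r : 0ℝ ≤ r) (Nr≈1 : fromNat N * r ≈ 1ℝ) where

  p : Fin (suc N) → ℝ
  p i = a + (b - a) * (fromNat (toℕ i) * r)

  step : ∀ i → p (suc i) - p (inject₁ i) ≈ (b - a) * r
  step i = affine-step a (b - a) r
    (≈-trans (fromNat-suc (toℕ i)) (+-cong ≈-refl (fromNat-cong (≡.sym (Fin.toℕ-inject₁ i)))))

  partition : TaggedPartition a b
  partition = record
    { size        = N
    ; point       = p
    ; tag         = λ i → p (suc i)
    ; point-first = affine-first a b r
    ; point-last  = affine-last a b (≈-trans (*-cong (fromNat-cong (Fin.toℕ-fromℕ N)) ≈-refl) Nr≈1)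
    ; point≤tag   = λ i → 0≤y-x⇒x≤y
        (≤-trans (*-nonNeg (x≤y⇒0≤y-x a≤b) 0≤r) (≤-reflexive (≈-sym (step i))))
    ; tag≤point   = λ i → ≤-refl
    }

  mesh : ∀ {δ} → (b - a) * r ≤ fromℚ δ → TaggedPartition.MeshAtMost partition δ
  mesh h i = ≤-trans (≤-reflexive (step i)) h

uniform : ∀ {a b} → a ≤ b → ∀ δ → 0ℚ ℚ.< δ →
  Σ (TaggedPartition a b) λ P → TaggedPartition.MeshAtMost P δ
uniform {a} {b} a≤b δ 0<δ =
  let B , 0<B , w≤B = ∣∣-bounded (b - a)
      q , 0<q , Bq≡δ = quotient B δ 0<B 0<δ
      N , r , 0≤r , r≤q , Nr≡1 = unit-fraction q 0<q
      open Uniform a≤b (suc N) (fromℚ r) (fromℚ-mono-≤ 0≤r) (pointwise λ _ → Nr≡1)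
  in partition , mesh (≤-trans
       (*-mono-≤ (x≤y⇒0≤y-x a≤b) (fromℚ-mono-≤ (ℚ.<⇒≤ 0<q))
         (≤-trans (x≤∣x∣ (b - a)) w≤B) (fromℚ-mono-≤ r≤q))
       (≤-reflexive (pointwise λ _ → Bq≡δ)))

isIntegral-unique : ∀ {a b f I J} → a ≤ b →
  IsRiemannIntegral a b f I → IsRiemannIntegral a b f J → I ≈ J
isIntegral-unique {a} {b} {f} {I} {J} a≤b hI hJ = ∣x-y∣≤ε⇒x≈y λ ε 0<ε →
  let η , 0<η , η+η≡ε = halve ε 0<ε
      α , 0<α , hα = approximates hI η 0<η
      β , 0<β , hβ = approximates hJ η 0<η
      δ , 0<δ , δ≤α , δ≤β = common 0<α 0<β
      P , mesh = uniform a≤b δ 0<δ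
      S = riemannSum f P
  in ≤-trans (∣x-z∣≤∣x-y∣+∣y-z∣ I S J) (≤-resp (+-cong (∣x-y∣≈∣y-x∣ I S) ≈-refl)
       (pointwise λ _ → ≡.sym η+η≡ε)
       (+-mono-≤ (hα P λ i → ≤-trans (mesh i) (fromℚ-mono-≤ δ≤α))
                 (hβ P λ i → ≤-trans (mesh i) (fromℚ-mono-≤ δ≤β))))

^-nonNeg : ∀ {x} k → 0ℝ ≤ x → 0ℝ ≤ x ^ k
^-nonNeg zero    0≤x = fromℚ-mono-≤ (ℚ.<⇒≤ 1>0)
^-nonNeg (suc k) 0≤x = *-nonNeg 0≤x (^-nonNeg k 0≤x)

^-mono-≤ : ∀ {x y} k → 0ℝ ≤ x → x ≤ y → x ^ k ≤ y ^ k
^-mono-≤ zero    0≤x x≤y = ≤-refl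
^-mono-≤ (suc k) 0≤x x≤y = *-mono-≤ 0≤x (^-nonNeg k (≤-trans 0≤x x≤y)) x≤y (^-mono-≤ k 0≤x x≤y)

1^ : ∀ k → 1ℝ ^ k ≈ 1ℝ
1^ zero    = ≈-refl
1^ (suc k) = ≈-trans (*-cong ≈-refl (1^ k)) (pointwise λ _ → ℚ.*-identityˡ 1ℚ)

fromNat-nonNeg : ∀ k → 0ℝ ≤ fromNat k
fromNat-nonNeg k = fromℚ-mono-≤ (ℚ.nonNegative⁻¹ (+ k ℚ./ 1) {{ℚ.normalize-nonNeg k 1}})

deriv : ℕ → ℝ → ℝ
deriv k t = fromNat (suc k) * t ^ k

deriv-mono-≤ : ∀ {x y} k → 0ℝ ≤ x → x ≤ y → deriv k x ≤ deriv k y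
deriv-mono-≤ k 0≤x x≤y = *-mono-≤ (fromNat-nonNeg (suc k)) (^-nonNeg k (≤-trans 0≤x x≤y))
  ≤-refl (^-mono-≤ k 0≤x x≤y)

deriv-nonNeg : ∀ {x} k → 0ℝ ≤ x → 0ℝ ≤ deriv k x
deriv-nonNeg k 0≤x = *-nonNeg (fromNat-nonNeg (suc k)) (^-nonNeg k 0≤x)

private
  expand : ∀ {m} k p x y → m ≈ 1ℝ + k → (m * (x * p)) * (y - x) ≈ (x * p) * (y - x) + x * ((k * p) * (y - x))
  expand k p x y m≈1+k = ≈-trans (*-cong (*-cong m≈1+k ≈-refl) ≈-refl)
    (pointwise λ n → eq (seq k n) (seq p n) (seq x n) (seq y n))
    where
    open +-*-Solver
    eq : ∀ k p x y → ((1ℚ ℚ.+ k) ℚ.* (x ℚ.* p)) ℚ.* (y ℚ.- x) ≡ (x ℚ.* p) ℚ.* (y ℚ.- x) ℚ.+ x ℚ.* ((k ℚ.* p) ℚ.* (y ℚ.- x))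
    eq = solve 4 (λ k p x y → ((con 1ℚ :+ k) :* (x :* p)) :* (y :- x) := (x :* p) :* (y :- x) :+ x :* ((k :* p) :* (y :- x))) refl

  regroup : ∀ x y p q → y * q - x * p ≈ q * (y - x) + x * (q - p)
  regroup x y p q = pointwise λ n → eq (seq x n) (seq y n) (seq p n) (seq q n)
    where
    open +-*-Solver
    eq : ∀ x y p q → y ℚ.* q ℚ.- x ℚ.* p ≡ q ℚ.* (y ℚ.- x) ℚ.+ x ℚ.* (q ℚ.- p)
    eq = solve 4 (λ x y p q → y :* q :- x :* p := q :* (y :- x) :+ x :* (q :- p)) refl

  regroup′ : ∀ x y p q → y * q - x * p ≈ p * (y - x) + y * (q - p)
  regroup′ x y p q = pointwise λ n → eq (seq x n) (seq y n) (seq p n) (seq q n)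
    where
    open +-*-Solver
    eq : ∀ x y p q → y ℚ.* q ℚ.- x ℚ.* p ≡ p ℚ.* (y ℚ.- x) ℚ.+ y ℚ.* (q ℚ.- p)
    eq = solve 4 (λ x y p q → y :* q :- x :* p := p :* (y :- x) :+ y :* (q :- p)) refl

  expand′ : ∀ {m} k p x y → m ≈ 1ℝ + k → (m * (y * p)) * (y - x) ≈ (y * p) * (y - x) + y * ((k * p) * (y - x))
  expand′ k p x y m≈1+k = ≈-trans (*-cong (*-cong m≈1+k ≈-refl) ≈-refl)
    (pointwise λ n → eq (seq k n) (seq p n) (seq x n) (seq y n))
    where
    open +-*-Solver
    eq : ∀ k p x y → ((1ℚ ℚ.+ k) ℚ.* (y ℚ.* p)) ℚ.* (y ℚ.- x) ≡ (y ℚ.* p) ℚ.* (y ℚ.- x) ℚ.+ y ℚ.* ((k ℚ.* p) ℚ.* (y ℚ.- x))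
    eq = solve 4 (λ k p x y → ((con 1ℚ :+ k) :* (y :* p)) :* (y :- x) := (y :* p) :* (y :- x) :+ y :* ((k :* p) :* (y :- x))) refl

  linear : ∀ x y → (1ℝ * 1ℝ) * (y - x) ≈ y * 1ℝ - x * 1ℝ
  linear x y = pointwise λ n → eq (seq x n) (seq y n)
    where
    open +-*-Solver
    eq : ∀ x y → (1ℚ ℚ.* 1ℚ) ℚ.* (y ℚ.- x) ≡ y ℚ.* 1ℚ ℚ.- x ℚ.* 1ℚ
    eq = solve 2 (λ x y → (con 1ℚ :* con 1ℚ) :* (y :- x) := y :* con 1ℚ :- x :* con 1ℚ) refl

^-lower : ∀ {x y} k → 0ℝ ≤ x → x ≤ y → deriv k x * (y - x) ≤ y ^ suc k - x ^ suc k
^-lower {x} {y} zero    0≤x x≤y = ≤-reflexive (linear x y)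
^-lower {x} {y} (suc k) 0≤x x≤y = ≤-resp
  (expand (fromNat (suc k)) (x ^ k) x y (fromNat-suc (suc k)))
  (regroup x y (x ^ suc k) (y ^ suc k))
  (+-mono-≤
    (*-mono-≤ (^-nonNeg (suc k) 0≤x) 0≤w (^-mono-≤ (suc k) 0≤x x≤y) ≤-refl)
    (*-mono-≤ 0≤x (x≤y⇒0≤y-x (^-mono-≤ (suc k) 0≤x x≤y)) ≤-refl (^-lower k 0≤x x≤y)))
  where
  0≤w : 0ℝ ≤ y - x
  0≤w = x≤y⇒0≤y-x x≤y

^-upper : ∀ {x y} k → 0ℝ ≤ x → x ≤ y → y ^ suc k - x ^ suc k ≤ deriv k y * (y - x)
^-upper {x} {y} zero    0≤x x≤y = ≤-reflexive (≈-sym (linear x y))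
^-upper {x} {y} (suc k) 0≤x x≤y = ≤-resp
  (regroup′ x y (x ^ suc k) (y ^ suc k))
  (expand′ (fromNat (suc k)) (y ^ k) x y (fromNat-suc (suc k)))
  (+-mono-≤
    (*-mono-≤ (^-nonNeg (suc k) 0≤x) 0≤w (^-mono-≤ (suc k) 0≤x x≤y) ≤-refl)
    (*-mono-≤ 0≤y (*-nonNeg (deriv-nonNeg k 0≤y) 0≤w) ≤-refl (^-upper k 0≤x x≤y)))
  where
  0≤w : 0ℝ ≤ y - x
  0≤w = x≤y⇒0≤y-x x≤y
  0≤y : 0ℝ ≤ y
  0≤y = ≤-trans 0≤x x≤y

interval-bound : ∀ {l u x y} → l ≤ x → x ≤ u → l ≤ y → y ≤ u → ∣ x - y ∣ ≤ u - l
interval-bound {l} {u} {x} {y} l≤x x≤u l≤y y≤u = ∣∣-bound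
  (+-mono-≤ x≤u (-‿anti-≤ l≤y))
  (≤-resp (pointwise λ n → eq (seq x n) (seq y n)) ≈-refl (+-mono-≤ y≤u (-‿anti-≤ l≤x)))
  where
  open +-*-Solver
  eq : ∀ x y → ℚ.- (x ℚ.- y) ≡ y ℚ.- x
  eq = solve 2 (λ x y → :- (x :- y) := y :- x) refl

mean-value : ∀ {x t y} k → 0ℝ ≤ x → x ≤ t → t ≤ y →
  ∣ deriv k t * (y - x) - (y ^ suc k - x ^ suc k) ∣ ≤ (deriv k y - deriv k x) * (y - x)
mean-value {x} {t} {y} k 0≤x x≤t t≤y = ≤-trans
  (interval-bound
    (*-mono-≤ (deriv-nonNeg k 0≤x) 0≤w (deriv-mono-≤ k 0≤x x≤t) ≤-refl)
    (*-mono-≤ (deriv-nonNeg k 0≤t) 0≤w (deriv-mono-≤ k 0≤t t≤y) ≤-refl)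
    (^-lower k 0≤x x≤y) (^-upper k 0≤x x≤y))
  (≤-reflexive (pointwise λ n → eq (seq (deriv k y) n) (seq (deriv k x) n) (seq (y - x) n)))
  where
  open +-*-Solver
  eq : ∀ p q w → p ℚ.* w ℚ.- q ℚ.* w ≡ (p ℚ.- q) ℚ.* w
  eq = solve 3 (λ p q w → p :* w :- q :* w := (p :- q) :* w) refl
  0≤t : 0ℝ ≤ t
  0≤t = ≤-trans 0≤x x≤t
  x≤y : x ≤ y
  x≤y = ≤-trans x≤t t≤y
  0≤w : 0ℝ ≤ y - x
  0≤w = x≤y⇒0≤y-x x≤y

first≤ : ∀ {n} (p : Fin (suc n) → ℝ) → (∀ i → p (inject₁ i) ≤ p (suc i)) → ∀ i → p zero ≤ p i
first≤         p mono zero    = ≤-refl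
first≤ {suc n} p mono (suc i) = ≤-trans (mono zero) (first≤ (p ∘ suc) (mono ∘ suc) i)

sum-sub : ∀ {n} (u v : Fin n → ℝ) → sum u - sum v ≈ ∑[ i < n ] (u i - v i)
sum-sub {zero}  u v = pointwise λ _ → refl
sum-sub {suc n} u v = ≈-trans
  (pointwise λ k → eq (seq (u zero) k) (seq (sum (u ∘ suc)) k) (seq (v zero) k) (seq (sum (v ∘ suc)) k))
  (+-cong ≈-refl (sum-sub (u ∘ suc) (v ∘ suc)))
  where
  open +-*-Solver
  eq : ∀ a b c d → (a ℚ.+ b) ℚ.- (c ℚ.+ d) ≡ (a ℚ.- c) ℚ.+ (b ℚ.- d)
  eq = solve 4 (λ a b c d → (a :+ b) :- (c :+ d) := (a :- c) :+ (b :- d)) refl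

-- For the increasing function `deriv k` the error is at most the mesh
-- times the total increase.

isIntegral-deriv : ∀ k → IsRiemannIntegral 0ℝ 1ℝ (deriv k) (1ℝ ^ suc k - 0ℝ ^ suc k)
approximates (isIntegral-deriv k) ε 0<ε = δ , 0<δ , error
  where
  D : ℚ
  D = + suc k ℚ./ 1
  D-pos : 0ℚ ℚ.< D
  D-pos = ℚ.positive⁻¹ D {{ℚ.normalize-pos (suc k) 1}}
  δ : ℚ
  δ = proj₁ (quotient D ε D-pos 0<ε)
  0<δ : 0ℚ ℚ.< δ
  0<δ = proj₁ (proj₂ (quotient D ε D-pos 0<ε))
  Dδ≡ε : D ℚ.* δ ≡ ε
  Dδ≡ε = proj₂ (proj₂ (quotient D ε D-pos 0<ε))
  error : (P : TaggedPartition 0ℝ 1ℝ) → TaggedPartition.MeshAtMost P δ →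
    ∣ riemannSum (deriv k) P - (1ℝ ^ suc k - 0ℝ ^ suc k) ∣ ≤ fromℚ ε
  error P mesh = ≤-trans
    (∣∣-resp
      (≈-trans
        (+-cong ≈-refl (-‿cong (≈-sym (≈-trans (sum-telescope (λ i → point i ^ suc k))
          (+-cong (^-congˡ (suc k) point-last) (-‿cong (^-congˡ (suc k) point-first)))))))
        (sum-sub (λ i → deriv k (tag i) * width i)
                 (λ i → point (suc i) ^ suc k - point (inject₁ i) ^ suc k)))
      (∣sum∣≤ bound))
    (≤-resp
      (≈-sym (*-distribʳ-sum (fromℚ δ) (λ i → deriv k (point (suc i)) - deriv k (point (inject₁ i)))))
      (pointwise λ _ → ≡.sym Dδ≡ε)
      (*-mono-≤ 0≤total (fromℚ-mono-≤ (ℚ.<⇒≤ 0<δ)) total≤D ≤-refl))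
    where
    open TaggedPartition P
    open Sum using (*-distribʳ-sum)
    open Exp using (^-congˡ)
    total : ℝ
    total = ∑[ i < size ] (deriv k (point (suc i)) - deriv k (point (inject₁ i)))
    mono : ∀ i → point (inject₁ i) ≤ point (suc i)
    mono i = ≤-trans (point≤tag i) (tag≤point i)
    nonNeg : ∀ i → 0ℝ ≤ point i
    nonNeg i = ≤-trans (≤-reflexive (≈-sym point-first)) (first≤ point mono i)
    increase : ∀ i → 0ℝ ≤ deriv k (point (suc i)) - deriv k (point (inject₁ i))
    increase i = x≤y⇒0≤y-x (deriv-mono-≤ k (nonNeg (inject₁ i)) (mono i))
    bound : ∀ i → ∣ deriv k (tag i) * width i - (point (suc i) ^ suc k - point (inject₁ i) ^ suc k) ∣
              ≤ (deriv k (point (suc i)) - deriv k (point (inject₁ i))) * fromℚ δ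
    bound i = ≤-trans (mean-value k (nonNeg (inject₁ i)) (point≤tag i) (tag≤point i))
      (*-mono-≤ (increase i) (fromℚ-mono-≤ (ℚ.<⇒≤ 0<δ)) ≤-refl (mesh i))
    telescoped : total ≈ deriv k (point (fromℕ size)) - deriv k (point zero)
    telescoped = sum-telescope (λ i → deriv k (point i))
    0≤total : 0ℝ ≤ total
    0≤total = ≤-trans
      (x≤y⇒0≤y-x (deriv-mono-≤ k (nonNeg zero) (first≤ point mono (fromℕ size))))
      (≤-reflexive (≈-sym telescoped))
    total≤D : total ≤ fromNat (suc k)
    total≤D = ≤-trans (≤-reflexive telescoped)
      (≤-resp ≈-refl (pointwise λ _ → ≡.trans (≡.sym (ℚ.*-identityʳ D)) (≡.sym (ℚ.+-identityʳ (D ℚ.* 1ℚ))))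
        (+-mono-≤
          (≤-reflexive (*-cong ≈-refl (≈-trans (^-congˡ k point-last) (1^ k))))
          (≤-resp ≈-refl (pointwise {0ℝ} { - 0ℝ} λ _ → refl) (-‿anti-≤ (deriv-nonNeg k (nonNeg zero))))))

integrable-^ : ∀ k → Integrable 0ℝ 1ℝ (_^ k)
integrable-^ k = mkIntegrable (c * (1ℝ ^ suc k - 0ℝ ^ suc k))
  (isIntegral-cong cancel ≈-refl (isIntegral-* c (isIntegral-deriv k)))
  where
  D : ℚ
  D = + suc k ℚ./ 1
  D≢0 : ℚ.NonZero D
  D≢0 = ℚ.pos⇒nonZero D {{ℚ.normalize-pos (suc k) 1}}
  c : ℝ
  c = fromℚ ((ℚ.1/ D) {{D≢0}})
  cancel : ∀ t → c * deriv k t ≈ t ^ k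
  cancel t = ≈-trans (≈-sym (*-assoc c (fromNat (suc k)) (t ^ k)))
    (≈-trans (*-cong (pointwise λ _ → ℚ.*-inverseˡ D {{D≢0}}) ≈-refl) (*-identityˡ (t ^ k)))
    where open CommutativeRing ℝ-commutativeRing using (*-assoc; *-identityˡ)

integrable-cong : ∀ {a b f g} → (∀ t → f t ≈ g t) → Integrable a b f → Integrable a b g
integrable-cong f≈g (mkIntegrable I h) = mkIntegrable I (isIntegral-cong f≈g ≈-refl h)

-- The stronger form, with a monomial factor, is what is preserved by
-- multiplication with an affine function.

PolynomialLike : (ℝ → ℝ) → Set
PolynomialLike f = ∀ k → Integrable 0ℝ 1ℝ (λ t → t ^ k * f t)

polynomial-1 : PolynomialLike (λ _ → 1ℝ)
polynomial-1 k = integrable-cong (λ t → ≈-sym (*-identityʳ (t ^ k))) (integrable-^ k)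
  where open CommutativeRing ℝ-commutativeRing using (*-identityʳ)

polynomial-affine : ∀ {f} α β → PolynomialLike f → PolynomialLike (λ t → f t * (α * t + β))
polynomial-affine {f} α β h k =
  let mkIntegrable I hI = h (suc k)
      mkIntegrable J hJ = h k
  in mkIntegrable (α * I + β * J) (isIntegral-cong
    (λ t → pointwise {α * (t ^ suc k * f t) + β * (t ^ k * f t)} {t ^ k * (f t * (α * t + β))}
      λ n → eq (seq α n) (seq β n) (seq t n) (seq (t ^ k) n) (seq (f t) n))
    ≈-refl (isIntegral-+ (isIntegral-* α hI) (isIntegral-* β hJ)))
  where
  open +-*-Solver
  eq : ∀ α β t p f → α ℚ.* ((t ℚ.* p) ℚ.* f) ℚ.+ β ℚ.* (p ℚ.* f) ≡ p ℚ.* (f ℚ.* (α ℚ.* t ℚ.+ β))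
  eq = solve 5 (λ α β t p f → α :* ((t :* p) :* f) :+ β :* (p :* f) := p :* (f :* (α :* t :+ β))) refl

polynomial-cong : ∀ {f g} → (∀ t → f t ≈ g t) → PolynomialLike f → PolynomialLike g
polynomial-cong f≈g h k = integrable-cong (λ t → *-cong ≈-refl (f≈g t)) (h k)

polynomial-integrable : ∀ {f} → PolynomialLike f → Integrable 0ℝ 1ℝ f
polynomial-integrable {f} h = integrable-cong (λ t → *-identityˡ (f t)) (h 0)
  where open CommutativeRing ℝ-commutativeRing using (*-identityˡ)

infixl 7 _/!_

_/!_ : ℝ → ℕ → ℝ
x /! n = x * fromℚ ((+ 1 ℚ./ (n !)) {{n ℕ.!≢0}})

fallingFactorial : ℝ → ℕ → ℝ
fallingFactorial z zero    = 1ℝ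
fallingFactorial z (suc n) = fallingFactorial z n * (z - fromNat n)

binomial : ℝ → ℕ → ℝ
binomial z n = fallingFactorial z n /! n

fallingFactorial-cong : ∀ {z w} n → z ≈ w → fallingFactorial z n ≈ fallingFactorial w n
fallingFactorial-cong zero    z≈w = ≈-refl
fallingFactorial-cong (suc n) z≈w = *-cong (fallingFactorial-cong n z≈w) (+-cong z≈w ≈-refl)

binomial-cong : ∀ {z w} n → z ≈ w → binomial z n ≈ binomial w n
binomial-cong n z≈w = *-cong (fallingFactorial-cong n z≈w) ≈-refl

binomial-integrable : ∀ α β n → Integrable 0ℝ 1ℝ (λ t → binomial (α * t + β) n)
binomial-integrable α β n =
  let mkIntegrable I h = polynomial-integrable (falling n)
  in mkIntegrable (fromℚ q * I) (isIntegral-cong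
    (λ t → *-comm (fromℚ q) (fallingFactorial (α * t + β) n)) ≈-refl
    (isIntegral-* (fromℚ q) h))
  where
  open CommutativeRing ℝ-commutativeRing using (*-comm; +-assoc)
  q : ℚ
  q = (+ 1 ℚ./ (n !)) {{n ℕ.!≢0}}
  falling : ∀ n → PolynomialLike (λ t → fallingFactorial (α * t + β) n)
  falling zero    = polynomial-1
  falling (suc n) = polynomial-cong
    (λ t → *-cong ≈-refl (≈-sym (+-assoc (α * t) β (- fromNat n))))
    (polynomial-affine α (β - fromNat n) (falling n))

binomial[t-x]-integrable : ∀ x n → Integrable 0ℝ 1ℝ (λ t → binomial (t - x) n)
binomial[t-x]-integrable x n =
  integrable-cong (λ t → binomial-cong n (+-cong (*-identityˡ t) (≈-refl { - x}))) (binomial-integrable 1ℝ (- x) n)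
  where open CommutativeRing ℝ-commutativeRing using (*-identityˡ)

binomial[x-t]-integrable : ∀ x n → Integrable 0ℝ 1ℝ (λ t → binomial (x - t) n)
binomial[x-t]-integrable x n =
  integrable-cong (λ t → binomial-cong n (pointwise { - 1ℝ * t + x} {x - t} λ k → eq (seq t k) (seq x k)))
    (binomial-integrable (- 1ℝ) x n)
  where
  open +-*-Solver
  eq : ∀ t x → (ℚ.- 1ℚ) ℚ.* t ℚ.+ x ≡ x ℚ.- t
  eq = solve 2 (λ t x → (:- con 1ℚ) :* t :+ x := x :- t) refl

cPoly ĉPoly : ℕ → ℝ → ℝ
cPoly n x = fromNat (n !) * ∫ 0ℝ 1ℝ (λ t → binomial (t - x) n) (binomial[t-x]-integrable x n)
ĉPoly n x = fromNat (n !) * ∫ 0ℝ 1ℝ (λ t → binomial (x - t) n) (binomial[x-t]-integrable x n)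

cNum ĉNum : ℕ → ℝ
cNum n = cPoly n 0ℝ
ĉNum n = ĉPoly n 0ℝ

{-# OPTIONS --safe #-}

-- Both recurrences hold under the integral sign.  With (z)ₙ the falling
-- factorial, (z)ₙ₊₁ = (z)ₙ (z − n) accounts for the term in cₙ(x), respectively
-- ĉₙ(x), and leaves t (t − x)ₙ, respectively − t (x − t)ₙ.  Since
-- (z)ₘ₊₁ = z (z − 1)ₘ, what has to be expanded is (t − x)ₙ along binomials in
-- − t − 1, respectively (x − t)ₙ along binomials in t − 1.  After upper negation
-- (z)ₙ = (−1)ⁿ (n − 1 − z)ₙ both expansions are instances of the
-- Chu–Vandermonde identity.

module Submission where

open import Defs
open import Algebra.Bundles using (CommutativeRing)
import Algebra.Properties.Ring
import Algebra.Properties.Semiring.Exp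
import Algebra.Properties.Semiring.Sum
import Algebra.Solver.Ring
open import Algebra.Solver.Ring.AlmostCommutativeRing
  using (fromCommutativeRing; _-Raw-AlmostCommutative⟶_; Induced-equivalence)
open import Data.Fin.Base using (Fin; zero; suc; toℕ)
import Data.Fin.Properties as Fin
open import Data.Integer.Base using (+_)
import Data.Integer.Properties as ℤ
open import Data.Maybe.Base using (map)
open import Data.Nat.Base as ℕ using (ℕ; zero; suc; _∸_; _!)
import Data.Nat.Properties as ℕ
open import Data.Product using (_×_; _,_)
open import Data.Rational.Base as ℚ using (0ℚ; 1ℚ)
import Data.Rational.Properties as ℚ
import Data.Rational.Unnormalised.Base as ℚᵘ
import Data.Rational.Unnormalised.Properties as ℚᵘ
open import Function using (_∘_)
open import Relation.Binary.Definitions using (WeaklyDecidable)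
open import Relation.Binary.PropositionalEquality as ≡ using (_≡_; refl)
import Relation.Binary.Reasoning.Setoid
open import Relation.Nullary.Decidable using (dec⇒maybe)

open CommutativeRing ℝ-commutativeRing
  using (setoid; ring; +-assoc; +-congˡ; +-congʳ; +-identityʳ;
    *-assoc; *-comm; *-congˡ; *-congʳ; *-identityˡ; *-identityʳ)
open Algebra.Properties.Semiring.Exp semiring using (^-homo-*; ^-congʳ)
open Algebra.Properties.Semiring.Sum semiring using (sum-cong-≋; ∑-distrib-+; *-distribˡ-sum)
open Algebra.Properties.Ring ring using (-1*x≈-x)
open Relation.Binary.Reasoning.Setoid setoid

-- Ring solver for the reals, with rational coefficients.

fromℚ-morphism : CommutativeRing.rawRing ℚ.+-*-commutativeRing
  -Raw-AlmostCommutative⟶ fromCommutativeRing ℝ-commutativeRing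
fromℚ-morphism = record
  { ⟦_⟧    = fromℚ
  ; +-homo = λ _ _ → pointwise λ _ → refl
  ; *-homo = λ _ _ → pointwise λ _ → refl
  ; -‿homo = λ _ → pointwise λ _ → refl
  ; 0-homo = ≈-refl
  ; 1-homo = ≈-refl
  }

fromℚ-cong : ∀ {p q} → p ≡ q → fromℚ p ≈ fromℚ q
fromℚ-cong refl = ≈-refl

-- Coefficients are compared in ℚ, where equality is decidable; equality of Cauchy reals cannot be
-- decided.
_fromℚ≟_ : WeaklyDecidable (Induced-equivalence fromℚ-morphism)
p fromℚ≟ q = map fromℚ-cong (dec⇒maybe (p ℚ.≟ q))

module ℝ-Solver = Algebra.Solver.Ring
  (CommutativeRing.rawRing ℚ.+-*-commutativeRing)
  (fromCommutativeRing ℝ-commutativeRing)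
  fromℚ-morphism _fromℚ≟_
open ℝ-Solver using (solve; _:=_; _:+_; _:*_; _:-_; :-_; con)

-- Natural numbers and inverse factorials in ℝ.

fromNat-+ : ∀ m n → fromNat (m ℕ.+ n) ≈ fromNat m + fromNat n
fromNat-+ zero    n = solve 1 (λ n → n := con 0ℚ :+ n) ≈-refl (fromNat n)
fromNat-+ (suc m) n = begin
  fromNat (suc (m ℕ.+ n))    ≈⟨ fromNat-suc (m ℕ.+ n) ⟩
  1ℝ + fromNat (m ℕ.+ n)     ≈⟨ +-congˡ (fromNat-+ m n) ⟩
  1ℝ + (fromNat m + fromNat n) ≈⟨ +-assoc 1ℝ (fromNat m) (fromNat n) ⟨
  1ℝ + fromNat m + fromNat n ≈⟨ +-congʳ (fromNat-suc m) ⟨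
  fromNat (suc m) + fromNat n ∎

-- The fraction `+ k ℚ./ 1` is normalised by a gcd, which does not reduce for variable `k`; the
-- identity is read off from unnormalised fractions over 1 instead.
fromNat-* : ∀ m n → fromNat (m ℕ.* n) ≈ fromNat m * fromNat n
fromNat-* m n = pointwise λ _ → ℚ.toℚᵘ-injective
  (ℚᵘ.≃-trans (integer (m ℕ.* n)) (ℚᵘ.≃-trans (ℚᵘ.≃-reflexive (≡.cong (λ i → ℚᵘ.mkℚᵘ i 0) (ℤ.pos-* m n)))
    (ℚᵘ.≃-sym (ℚᵘ.≃-trans (ℚ.toℚᵘ-homo-* (+ m ℚ./ 1) (+ n ℚ./ 1)) (ℚᵘ.*-cong (integer m) (integer n))))))
  where
  integer : ∀ k → ℚ.toℚᵘ (+ k ℚ./ 1) ℚᵘ.≃ ℚᵘ.mkℚᵘ (+ k) 0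
  integer k = ℚ.toℚᵘ-fromℚᵘ (ℚᵘ.mkℚᵘ (+ k) 0)

fromNat-inverse : ∀ d .{{_ : ℕ.NonZero d}} → fromNat d * fromℚ (+ 1 ℚ./ d) ≈ 1ℝ
fromNat-inverse (suc d) = pointwise λ _ → ℚ.toℚᵘ-injective
  (ℚᵘ.≃-trans (ℚ.toℚᵘ-homo-* (+ suc d ℚ./ 1) (+ 1 ℚ./ suc d))
    (ℚᵘ.≃-trans
      (ℚᵘ.*-cong (ℚ.toℚᵘ-fromℚᵘ (ℚᵘ.mkℚᵘ (+ suc d) 0)) (ℚ.toℚᵘ-fromℚᵘ (ℚᵘ.mkℚᵘ (+ 1) d)))
      (ℚᵘ.*-inverseʳ (ℚᵘ.mkℚᵘ (+ suc d) 0))))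

fromNat-suc-cancel : ∀ n {x y} → fromNat (suc n) * x ≈ fromNat (suc n) * y → x ≈ y
fromNat-suc-cancel n {x} {y} eq = begin
  x                    ≈⟨ unit x ⟨
  r * (fromNat (suc n) * x) ≈⟨ *-congˡ eq ⟩
  r * (fromNat (suc n) * y) ≈⟨ unit y ⟩
  y                    ∎
  where
  r : ℝ
  r = fromℚ (+ 1 ℚ./ suc n)
  unit : ∀ z → r * (fromNat (suc n) * z) ≈ z
  unit z = begin
    r * (fromNat (suc n) * z)
      ≈⟨ solve 3 (λ r s z → r :* (s :* z) := (s :* r) :* z) ≈-refl r (fromNat (suc n)) z ⟩
    fromNat (suc n) * r * z   ≈⟨ *-congʳ (fromNat-inverse (suc n)) ⟩
    1ℝ * z               ≈⟨ *-identityˡ z ⟩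
    z                    ∎

/!-inverse : ∀ n x → fromNat (n !) * (x /! n) ≈ x
/!-inverse n x = begin
  fromNat (n !) * (x /! n)
    ≈⟨ solve 3 (λ f x r → f :* (x :* r) := x :* (f :* r)) ≈-refl (fromNat (n !)) x r ⟩
  x * (fromNat (n !) * r)            ≈⟨ *-congˡ (fromNat-inverse (n !) {{n ℕ.!≢0}}) ⟩
  x * 1ℝ                             ≈⟨ *-identityʳ x ⟩
  x                                  ∎
  where
  r : ℝ
  r = fromℚ ((+ 1 ℚ./ (n !)) {{n ℕ.!≢0}})

-- Inserting n! · (1 / n!) lets the factor n + 1 merge with n! into (n + 1)!, which then cancels
-- against its inverse.
/!-suc : ∀ n x → fromNat (suc n) * (x /! suc n) ≈ x /! n
/!-suc n x = begin
  S * (x /! suc n)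
    ≈⟨ solve 3 (λ s x r → s :* (x :* r) := x :* (s :* r)) ≈-refl S x (r (suc n)) ⟩
  x * (S * r (suc n))               ≈⟨ *-congˡ (/!-inverse n (S * r (suc n))) ⟨
  x * (F * (S * r (suc n) * r n))
    ≈⟨ *-congˡ (solve 4 (λ f s r q → f :* (s :* r :* q) := s :* f :* r :* q) ≈-refl
         F S (r (suc n)) (r n)) ⟩
  x * (S * F * r (suc n) * r n)     ≈⟨ *-congˡ (*-congʳ (*-congʳ (≈-sym (fromNat-* (suc n) (n !))))) ⟩
  x * (fromNat (suc n !) * r (suc n) * r n)
    ≈⟨ *-congˡ (*-congʳ (fromNat-inverse (suc n !) {{suc n ℕ.!≢0}})) ⟩
  x * (1ℝ * r n)                    ≈⟨ *-congˡ (*-identityˡ (r n)) ⟩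
  x /! n                            ∎
  where
  F S : ℝ
  F = fromNat (n !)
  S = fromNat (suc n)
  r : ℕ → ℝ
  r k = fromℚ ((+ 1 ℚ./ (k !)) {{k ℕ.!≢0}})

-- Convolution and the Chu-Vandermonde identity.

infixl 7 _⋆_

-- The Cauchy product: multiplication of formal power series given by their coefficients.
_⋆_ : (ℕ → ℝ) → (ℕ → ℝ) → ℕ → ℝ
(f ⋆ g) n = ∑[ m ≤ n ] (f (toℕ m) * g (n ∸ toℕ m))

-- The sum unfolds at m = 0, but in `f ⋆ θ g` the vanishing term is the last one. Induction peels m
-- = 0 and shifts `f`, which keeps the truncated differences reducing on both sides.
⋆-last : ∀ f g n → (f ⋆ g) (suc n) ≈ (f ⋆ (g ∘ suc)) n + f (suc n) * g 0
⋆-last f g zero = solve 3 (λ a b z → a :+ (b :+ z) := (a :+ z) :+ b) ≈-refl (f 0 * g 1) (f 1 * g 0) 0ℝ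
⋆-last f g (suc n) = begin
  f 0 * g (suc (suc n)) + ((f ∘ suc) ⋆ g) (suc n)
    ≈⟨ +-congˡ (⋆-last (f ∘ suc) g n) ⟩
  f 0 * g (suc (suc n)) + (((f ∘ suc) ⋆ (g ∘ suc)) n + f (suc (suc n)) * g 0)
    ≈⟨ +-assoc _ _ _ ⟨
  (f ⋆ (g ∘ suc)) (suc n) + f (suc (suc n)) * g 0 ∎

⋆-cong : ∀ {f f′ g g′} → (∀ n → f n ≈ f′ n) → (∀ n → g n ≈ g′ n) → ∀ n → (f ⋆ g) n ≈ (f′ ⋆ g′) n
⋆-cong f≈f′ g≈g′ n = sum-cong-≋ {suc n} λ m → *-cong (f≈f′ (toℕ m)) (g≈g′ (n ∸ toℕ m))

-- The Euler operator X d/dX on coefficient sequences, a derivation for _⋆_.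
θ : (ℕ → ℝ) → ℕ → ℝ
θ f n = fromNat n * f n

index-sum : ∀ {n} (m : Fin (suc n)) → toℕ m ℕ.+ (n ∸ toℕ m) ≡ n
index-sum m = ℕ.m+[n∸m]≡n (Fin.toℕ≤pred[n] m)

-- In each term the two indices add up to n, so the factor n distributes over the two sequences.
θ-⋆ : ∀ f g n → θ (f ⋆ g) n ≈ (θ f ⋆ g) n + (f ⋆ θ g) n
θ-⋆ f g n = begin
  fromNat n * (f ⋆ g) n
    ≈⟨ *-distribˡ-sum (fromNat n) (λ (m : Fin (suc n)) → f (toℕ m) * g (n ∸ toℕ m)) ⟩
  ∑[ m ≤ n ] (fromNat n * (f (toℕ m) * g (n ∸ toℕ m)))
    ≈⟨ sum-cong-≋ leibniz ⟩
  ∑[ m ≤ n ] (θ f (toℕ m) * g (n ∸ toℕ m) + f (toℕ m) * θ g (n ∸ toℕ m))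
    ≈⟨ ∑-distrib-+ {suc n} (λ m → θ f (toℕ m) * g (n ∸ toℕ m)) (λ m → f (toℕ m) * θ g (n ∸ toℕ m)) ⟩
  (θ f ⋆ g) n + (f ⋆ θ g) n ∎
  where
  leibniz : ∀ (m : Fin (suc n)) → fromNat n * (f (toℕ m) * g (n ∸ toℕ m)) ≈
            θ f (toℕ m) * g (n ∸ toℕ m) + f (toℕ m) * θ g (n ∸ toℕ m)
  leibniz m = begin
    fromNat n * (f i * g j)
      ≈⟨ *-congʳ (≈-trans (fromNat-cong (≡.sym (index-sum m))) (fromNat-+ i j)) ⟩
    (fromNat i + fromNat j) * (f i * g j)
      ≈⟨ solve 4 (λ i j f g → (i :+ j) :* (f :* g) := (i :* f) :* g :+ f :* (j :* g)) ≈-refl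
           (fromNat i) (fromNat j) (f i) (g j) ⟩
    θ f i * g j + f i * θ g j           ∎
    where
    i j : ℕ
    i = toℕ m
    j = n ∸ toℕ m

-- This is the coefficient of Xⁿ in (1 + X) F′ = z F, the differential equation of F = (1 + X)ᶻ.
binomial-suc : ∀ z n → θ (binomial z) (suc n) ≈ (z - fromNat n) * binomial z n
binomial-suc z n = begin
  fromNat (suc n) * (fallingFactorial z n * (z - fromNat n) /! suc n)
    ≈⟨ /!-suc n (fallingFactorial z n * (z - fromNat n)) ⟩
  fallingFactorial z n * (z - fromNat n) /! n
    ≈⟨ solve 3 (λ f w r → f :* w :* r := w :* (f :* r)) ≈-refl (fallingFactorial z n) (z - fromNat n) _ ⟩
  (z - fromNat n) * binomial z n ∎

binomial-zero : ∀ z → binomial z 0 ≈ 1ℝ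
binomial-zero z = *-identityˡ 1ℝ

-- Chu–Vandermonde: both sides satisfy (n + 1) uₙ₊₁ = (a + b − n) uₙ.
vandermonde : ∀ a b n → (binomial a ⋆ binomial b) n ≈ binomial (a + b) n
vandermonde a b zero = begin
  binomial a 0 * binomial b 0 + 0ℝ ≈⟨ +-congʳ (*-cong (binomial-zero a) (binomial-zero b)) ⟩
  1ℝ * 1ℝ + 0ℝ                     ≈⟨ solve 0 (con 1ℚ :* con 1ℚ :+ con 0ℚ := con 1ℚ) ≈-refl ⟩
  1ℝ                               ≈⟨ binomial-zero (a + b) ⟨
  binomial (a + b) 0               ∎
vandermonde a b (suc n) = fromNat-suc-cancel n (begin
  θ (f ⋆ g) (suc n)
    ≈⟨ θ-⋆ f g (suc n) ⟩
  (θ f ⋆ g) (suc n) + (f ⋆ θ g) (suc n)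
    ≈⟨ +-cong θ-first θ-last ⟩
  ((λ m → (a - fromNat m) * f m) ⋆ g) n + (f ⋆ (λ m → (b - fromNat m) * g m)) n
    ≈⟨ ∑-distrib-+ {suc n} (λ m → (a - fromNat (toℕ m)) * f (toℕ m) * g (n ∸ toℕ m))
                           (λ m → f (toℕ m) * ((b - fromNat (n ∸ toℕ m)) * g (n ∸ toℕ m))) ⟨
  ∑[ m ≤ n ] ((a - fromNat (toℕ m)) * f (toℕ m) * g (n ∸ toℕ m)
              + f (toℕ m) * ((b - fromNat (n ∸ toℕ m)) * g (n ∸ toℕ m)))
    ≈⟨ sum-cong-≋ combine ⟩
  ∑[ m ≤ n ] ((a + b - fromNat n) * (f (toℕ m) * g (n ∸ toℕ m)))
    ≈⟨ *-distribˡ-sum (a + b - fromNat n) (λ (m : Fin (suc n)) → f (toℕ m) * g (n ∸ toℕ m)) ⟨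
  (a + b - fromNat n) * (f ⋆ g) n
    ≈⟨ *-congˡ (vandermonde a b n) ⟩
  (a + b - fromNat n) * binomial (a + b) n
    ≈⟨ binomial-suc (a + b) n ⟨
  θ (binomial (a + b)) (suc n) ∎)
  where
  f g : ℕ → ℝ
  f = binomial a
  g = binomial b
  -- `θ f` vanishes at 0, so the term m = 0 drops out and the remaining terms are again indexed by m
  -- ≤ n.
  θ-first : (θ f ⋆ g) (suc n) ≈ ((λ m → (a - fromNat m) * f m) ⋆ g) n
  θ-first = begin
    θ f 0 * g (suc n) + ((θ f ∘ suc) ⋆ g) n
      ≈⟨ solve 3 (λ f g s → con 0ℚ :* f :* g :+ s := s) ≈-refl (f 0) (g (suc n)) (((θ f ∘ suc) ⋆ g) n) ⟩
    ((θ f ∘ suc) ⋆ g) n                     ≈⟨ ⋆-cong {g = g} (binomial-suc a) (λ _ → ≈-refl) n ⟩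
    ((λ m → (a - fromNat m) * f m) ⋆ g) n   ∎
  -- Here the vanishing term is m = n + 1, where `θ g` is taken at 0.
  θ-last : (f ⋆ θ g) (suc n) ≈ (f ⋆ (λ m → (b - fromNat m) * g m)) n
  θ-last = begin
    (f ⋆ θ g) (suc n)                             ≈⟨ ⋆-last f (θ g) n ⟩
    (f ⋆ (θ g ∘ suc)) n + f (suc n) * θ g 0
      ≈⟨ solve 3 (λ f g s → s :+ f :* (con 0ℚ :* g) := s) ≈-refl
           (f (suc n)) (g 0) ((f ⋆ (θ g ∘ suc)) n) ⟩
    (f ⋆ (θ g ∘ suc)) n                           ≈⟨ ⋆-cong {f = f} (λ _ → ≈-refl) (binomial-suc b) n ⟩
    (f ⋆ (λ m → (b - fromNat m) * g m)) n         ∎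
  -- The coefficients a - i and b - j add up to a + b - n, free of m, because i + j = n.
  combine : ∀ (m : Fin (suc n)) →
    (a - fromNat (toℕ m)) * f (toℕ m) * g (n ∸ toℕ m) + f (toℕ m) * ((b - fromNat (n ∸ toℕ m)) * g (n ∸ toℕ m))
    ≈ (a + b - fromNat n) * (f (toℕ m) * g (n ∸ toℕ m))
  combine m = begin
    (a - fromNat i) * f i * g j + f i * ((b - fromNat j) * g j)
      ≈⟨ solve 6 (λ a b i j f g → (a :- i) :* f :* g :+ f :* ((b :- j) :* g) := (a :+ b :- (i :+ j)) :* (f :* g)) ≈-refl
           a b (fromNat i) (fromNat j) (f i) (g j) ⟩
    (a + b - (fromNat i + fromNat j)) * (f i * g j)
      ≈⟨ *-congʳ (+-congˡ (-‿cong (≈-trans (≈-sym (fromNat-+ i j)) (fromNat-cong (index-sum m))))) ⟩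
    (a + b - fromNat n) * (f i * g j) ∎
    where
    i j : ℕ
    i = toℕ m
    j = n ∸ toℕ m

-- First factor and upper negation of falling factorials.

-- The definition grows at the last factor; the induction works because z - (n + 1) = (z - 1) - n.
fallingFactorial-first : ∀ z n → fallingFactorial z (suc n) ≈ z * fallingFactorial (z - 1ℝ) n
fallingFactorial-first z zero = solve 1 (λ z → con 1ℚ :* (z :- con 0ℚ) := z :* con 1ℚ) ≈-refl z
fallingFactorial-first z (suc n) = begin
  fallingFactorial z (suc n) * (z - fromNat (suc n))
    ≈⟨ *-cong (fallingFactorial-first z n) (+-congˡ (-‿cong (fromNat-suc n))) ⟩
  z * fallingFactorial (z - 1ℝ) n * (z - (1ℝ + fromNat n))
    ≈⟨ solve 3 (λ z f k → z :* f :* (z :- (con 1ℚ :+ k)) := z :* (f :* (z :- con 1ℚ :- k))) ≈-refl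
         z (fallingFactorial (z - 1ℝ) n) (fromNat n) ⟩
  z * fallingFactorial (z - 1ℝ) (suc n) ∎

-- All factors change sign and their order is reversed. The new last factor z - n thus becomes the
-- first factor n - z on the right, which is why `fallingFactorial-first` enters.
upper-negation : ∀ z n → fallingFactorial z n ≈ (- 1ℝ) ^ n * fallingFactorial (fromNat n - 1ℝ - z) n
upper-negation z zero = ≈-sym (*-identityˡ 1ℝ)
upper-negation z (suc n) = begin
  fallingFactorial z n * (z - fromNat n)
    ≈⟨ *-congʳ (upper-negation z n) ⟩
  (- 1ℝ) ^ n * fallingFactorial (fromNat n - 1ℝ - z) n * (z - fromNat n)
    ≈⟨ solve 4 (λ s f z k → s :* f :* (z :- k) := (:- con 1ℚ) :* s :* ((k :- z) :* f)) ≈-refl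
         ((- 1ℝ) ^ n) (fallingFactorial (fromNat n - 1ℝ - z) n) z (fromNat n) ⟩
  (- 1ℝ) ^ suc n * ((fromNat n - z) * fallingFactorial (fromNat n - 1ℝ - z) n)
    ≈⟨ *-congˡ (*-congˡ (fallingFactorial-cong n (solve 2 (λ k z → k :- con 1ℚ :- z := k :- z :- con 1ℚ) ≈-refl
         (fromNat n) z))) ⟩
  (- 1ℝ) ^ suc n * ((fromNat n - z) * fallingFactorial (fromNat n - z - 1ℝ) n)
    ≈⟨ *-congˡ (≈-sym (fallingFactorial-first (fromNat n - z) n)) ⟩
  (- 1ℝ) ^ suc n * fallingFactorial (fromNat n - z) (suc n)
    ≈⟨ *-congˡ (fallingFactorial-cong (suc n) shift-index) ⟩
  (- 1ℝ) ^ suc n * fallingFactorial (fromNat (suc n) - 1ℝ - z) (suc n) ∎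
  where
  shift-index : fromNat n - z ≈ fromNat (suc n) - 1ℝ - z
  shift-index = begin
    fromNat n - z
      ≈⟨ solve 2 (λ k z → k :- z := con 1ℚ :+ k :- con 1ℚ :- z) ≈-refl (fromNat n) z ⟩
    1ℝ + fromNat n - 1ℝ - z   ≈⟨ +-congʳ (+-congʳ (fromNat-suc n)) ⟨
    fromNat (suc n) - 1ℝ - z  ∎

binomial-upper-negation : ∀ z n → binomial z n ≈ (- 1ℝ) ^ n * binomial (fromNat n - 1ℝ - z) n
binomial-upper-negation z n = ≈-trans (*-congʳ (upper-negation z n))
  (solve 3 (λ s f r → s :* f :* r := s :* (f :* r)) ≈-refl
       ((- 1ℝ) ^ n) (fallingFactorial (fromNat n - 1ℝ - z) n) _)

-- The recurrences under the integral sign.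

fallingFactorial-suc-/! : ∀ z n → fallingFactorial z (suc n) /! n ≈ z * binomial (z - 1ℝ) n
fallingFactorial-suc-/! z n = ≈-trans (*-congʳ (fallingFactorial-first z n))
  (solve 3 (λ z f r → z :* f :* r := z :* (f :* r)) ≈-refl z (fallingFactorial (z - 1ℝ) n) _)

-- Taking z out of every term leaves a Vandermonde convolution with upper entries z - 1 and b, and
-- n! clears the denominator of its value. With z = 0 - t or z = t - 0 the falling factorials on the
-- left are the integrands of the Cauchy numbers.
shifted-vandermonde : ∀ z b n →
  fromNat (n !) * ∑[ m ≤ n ] (fallingFactorial z (suc (toℕ m)) /! toℕ m * binomial b (n ∸ toℕ m))
  ≈ z * fallingFactorial (z - 1ℝ + b) n
shifted-vandermonde z b n = begin
  F * ∑[ m ≤ n ] (fallingFactorial z (suc (toℕ m)) /! toℕ m * binomial b (n ∸ toℕ m))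
    ≈⟨ *-congˡ (sum-cong-≋ λ (m : Fin (suc n)) → ≈-trans (*-congʳ (fallingFactorial-suc-/! z (toℕ m)))
         (*-assoc z (binomial (z - 1ℝ) (toℕ m)) (binomial b (n ∸ toℕ m)))) ⟩
  F * ∑[ m ≤ n ] (z * (binomial (z - 1ℝ) (toℕ m) * binomial b (n ∸ toℕ m)))
    ≈⟨ *-congˡ (*-distribˡ-sum z (λ (m : Fin (suc n)) → binomial (z - 1ℝ) (toℕ m) * binomial b (n ∸ toℕ m))) ⟨
  F * (z * (binomial (z - 1ℝ) ⋆ binomial b) n)
    ≈⟨ *-congˡ (*-congˡ (vandermonde (z - 1ℝ) b n)) ⟩
  F * (z * binomial (z - 1ℝ + b) n)
    ≈⟨ solve 3 (λ f z c → f :* (z :* c) := z :* (f :* c)) ≈-refl F z (binomial (z - 1ℝ + b) n) ⟩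
  z * (F * binomial (z - 1ℝ + b) n)
    ≈⟨ *-congˡ (/!-inverse n (fallingFactorial (z - 1ℝ + b) n)) ⟩
  z * fallingFactorial (z - 1ℝ + b) n ∎
  where
  F : ℝ
  F = fromNat (n !)

integrand-recurrence₁ : ∀ n x t → fallingFactorial (t - x) (suc n) ≈
  - (fromNat n + x) * fallingFactorial (t - x) n
    + (- 1ℝ) ^ suc n * fromNat (n !)
      * ∑[ m ≤ n ] (fallingFactorial (0ℝ - t) (suc (toℕ m)) /! toℕ m
                     * binomial (x + fromNat n) (n ∸ toℕ m))
integrand-recurrence₁ n x t = begin
  fallingFactorial (t - x) n * (t - x - N)
    ≈⟨ *-congʳ negated ⟩
  s * g * (t - x - N)
    -- The last factor is split as t - x - n = -(n + x) + t. Writing t as -(0 - t) supplies the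
    -- extra sign in (-1)ⁿ⁺¹ and the factor z = 0 - t for Vandermonde.
    ≈⟨ solve 5 (λ k x t s g → s :* g :* (t :- x :- k) :=
                  (:- (k :+ x)) :* (s :* g) :+ (:- con 1ℚ) :* s :* ((con 0ℚ :- t) :* g)) ≈-refl N x t s g ⟩
  - (N + x) * (s * g) + (- 1ℝ) ^ suc n * ((0ℝ - t) * g)
    ≈⟨ +-cong (*-congˡ (≈-sym negated)) (*-congˡ (≈-sym (shifted-vandermonde (0ℝ - t) (x + N) n))) ⟩
  - (N + x) * fallingFactorial (t - x) n + (- 1ℝ) ^ suc n * (fromNat (n !) * Σ)
    ≈⟨ +-congˡ (*-assoc ((- 1ℝ) ^ suc n) (fromNat (n !)) Σ) ⟨
  - (N + x) * fallingFactorial (t - x) n + (- 1ℝ) ^ suc n * fromNat (n !) * Σ ∎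
  where
  N s g Σ : ℝ
  N = fromNat n
  s = (- 1ℝ) ^ n
  g = fallingFactorial (0ℝ - t - 1ℝ + (x + N)) n
  Σ = ∑[ m ≤ n ] (fallingFactorial (0ℝ - t) (suc (toℕ m)) /! toℕ m * binomial (x + N) (n ∸ toℕ m))
  negated : fallingFactorial (t - x) n ≈ s * g
  negated = ≈-trans (upper-negation (t - x) n) (*-congˡ (fallingFactorial-cong n
    (solve 3 (λ k x t → k :- con 1ℚ :- (t :- x) := con 0ℚ :- t :- con 1ℚ :+ (x :+ k)) ≈-refl N x t)))

integrand-recurrence₂ : ∀ n x t → fallingFactorial (x - t) (suc n) ≈
  (x - fromNat n) * fallingFactorial (x - t) n
    - fromNat (n !)
      * ∑[ m ≤ n ] ((- 1ℝ) ^ toℕ m * fallingFactorial (t - 0ℝ) (suc (toℕ m)) /! toℕ m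
                     * binomial (x - fromNat (toℕ m) - 1ℝ) (n ∸ toℕ m))
integrand-recurrence₂ n x t = begin
  fallingFactorial (x - t) n * (x - t - N)
    ≈⟨ *-congʳ negated ⟩
  s * g * (x - t - N)
    -- Here x - t - n = (x - n) - t, and t is written as t - 0 to match the integrand of `cNum`.
    ≈⟨ solve 5 (λ k x t s g → s :* g :* (x :- t :- k) :=
                  (x :- k) :* (s :* g) :- s :* ((t :- con 0ℚ) :* g)) ≈-refl N x t s g ⟩
  (x - N) * (s * g) - s * ((t - 0ℝ) * g)
    ≈⟨ +-cong (*-congˡ (≈-sym negated)) (-‿cong expanded) ⟩
  (x - N) * fallingFactorial (x - t) n - F * ∑[ m ≤ n ] u m ∎
  where
  N F s g : ℝ
  N = fromNat n
  F = fromNat (n !)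
  s = (- 1ℝ) ^ n
  g = fallingFactorial (t - 0ℝ - 1ℝ + (N - x)) n
  negated : fallingFactorial (x - t) n ≈ s * g
  negated = ≈-trans (upper-negation (x - t) n) (*-congˡ (fallingFactorial-cong n
    (solve 3 (λ k x t → k :- con 1ℚ :- (x :- t) := t :- con 0ℚ :- con 1ℚ :+ (k :- x)) ≈-refl N x t)))
  -- `u` is the summand wanted in the recurrence, `v` the one that Vandermonde supplies with second
  -- upper entry n - x.
  u v : Fin (suc n) → ℝ
  u m = (- 1ℝ) ^ toℕ m * fallingFactorial (t - 0ℝ) (suc (toℕ m)) /! toℕ m
          * binomial (x - fromNat (toℕ m) - 1ℝ) (n ∸ toℕ m)
  v m = fallingFactorial (t - 0ℝ) (suc (toℕ m)) /! toℕ m * binomial (N - x) (n ∸ toℕ m)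
  -- The upper entry of the second binomial loses its dependence on m.
  sign-out : ∀ m → s * v m ≈ u m
  sign-out m = begin
    s * (p /! i * binomial (N - x) j)
      -- Since n = i + j, the sign (-1)ⁿ splits: (-1)ⁱ stays in the summand, and (-1)ʲ is absorbed
      -- by upper negation of the second binomial.
      ≈⟨ *-congʳ (≈-trans (^-congʳ (- 1ℝ) (≡.sym (index-sum m))) (^-homo-* (- 1ℝ) i j)) ⟩
    (- 1ℝ) ^ i * (- 1ℝ) ^ j * (p /! i * binomial (N - x) j)
      ≈⟨ solve 5 (λ a b p r c → a :* b :* (p :* r :* c) := a :* p :* r :* (b :* c)) ≈-refl
           ((- 1ℝ) ^ i) ((- 1ℝ) ^ j) p _ (binomial (N - x) j) ⟩
    (- 1ℝ) ^ i * p /! i * ((- 1ℝ) ^ j * binomial (N - x) j)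
      ≈⟨ *-congˡ (*-congˡ (binomial-cong j (begin
           N - x
             ≈⟨ +-congʳ (≈-trans (fromNat-cong (≡.sym (index-sum m))) (fromNat-+ i j)) ⟩
           fromNat i + fromNat j - x
             ≈⟨ solve 3 (λ i j x → i :+ j :- x := j :- con 1ℚ :- (x :- i :- con 1ℚ)) ≈-refl
                  (fromNat i) (fromNat j) x ⟩
           fromNat j - 1ℝ - (x - fromNat i - 1ℝ) ∎))) ⟩
    (- 1ℝ) ^ i * p /! i * ((- 1ℝ) ^ j * binomial (fromNat j - 1ℝ - (x - fromNat i - 1ℝ)) j)
      ≈⟨ *-congˡ (binomial-upper-negation (x - fromNat i - 1ℝ) j) ⟨
    u m ∎
    where
    i j : ℕ
    i = toℕ m
    j = n ∸ toℕ m
    p : ℝ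
    p = fallingFactorial (t - 0ℝ) (suc i)
  expanded : s * ((t - 0ℝ) * g) ≈ F * ∑[ m ≤ n ] u m
  expanded = begin
    s * ((t - 0ℝ) * g)
      ≈⟨ *-congˡ (shifted-vandermonde (t - 0ℝ) (N - x) n) ⟨
    s * (F * ∑[ m ≤ n ] v m)
      ≈⟨ solve 3 (λ s f v → s :* (f :* v) := f :* (s :* v)) ≈-refl s F (∑[ m ≤ n ] v m) ⟩
    F * (s * ∑[ m ≤ n ] v m)
      ≈⟨ *-congˡ (≈-trans (*-distribˡ-sum s v) (sum-cong-≋ sign-out)) ⟩
    F * ∑[ m ≤ n ] u m ∎

-- Linearity of the integral, and the Cauchy polynomials as integrals.

module _ {a b : ℝ} where

  isIntegral-*ʳ : ∀ {f I} c → IsRiemannIntegral a b f I → IsRiemannIntegral a b (λ t → f t * c) (I * c)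
  isIntegral-*ʳ {f} {I} c h = isIntegral-cong (λ t → *-comm c (f t)) (*-comm c I) (isIntegral-* c h)

  isIntegral-/! : ∀ {f I} n → IsRiemannIntegral a b f I → IsRiemannIntegral a b (λ t → f t /! n) (I /! n)
  isIntegral-/! n = isIntegral-*ʳ (fromℚ ((+ 1 ℚ./ (n !)) {{n ℕ.!≢0}}))

  isIntegral-neg : ∀ {f I} → IsRiemannIntegral a b f I → IsRiemannIntegral a b (λ t → - f t) (- I)
  isIntegral-neg {f} {I} h = isIntegral-cong (λ t → -1*x≈-x (f t)) (-1*x≈-x I) (isIntegral-* (- 1ℝ) h)

  -- The sums have at least one term, so the induction starts from a single integrand, up to an
  -- added zero.
  isIntegral-sum : ∀ {n} {f : Fin (suc n) → ℝ → ℝ} {I : Fin (suc n) → ℝ} →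
    (∀ i → IsRiemannIntegral a b (f i) (I i)) → IsRiemannIntegral a b (λ t → ∑[ i ≤ n ] f i t) (∑[ i ≤ n ] I i)
  isIntegral-sum {zero}  h = isIntegral-cong (λ t → ≈-sym (+-identityʳ _)) (≈-sym (+-identityʳ _)) (h zero)
  isIntegral-sum {suc n} h = isIntegral-+ (h zero) (isIntegral-sum (h ∘ suc))

-- The factor n! of `cPoly` cancels the denominator of the binomial coefficient under the integral.
cPoly-isIntegral : ∀ n x → IsRiemannIntegral 0ℝ 1ℝ (λ t → fallingFactorial (t - x) n) (cPoly n x)
cPoly-isIntegral n x = isIntegral-cong (λ t → /!-inverse n (fallingFactorial (t - x) n)) ≈-refl
  (isIntegral-* (fromNat (n !)) (Integrable.isIntegral (binomial[t-x]-integrable x n)))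

ĉPoly-isIntegral : ∀ n x → IsRiemannIntegral 0ℝ 1ℝ (λ t → fallingFactorial (x - t) n) (ĉPoly n x)
ĉPoly-isIntegral n x = isIntegral-cong (λ t → /!-inverse n (fallingFactorial (x - t) n)) ≈-refl
  (isIntegral-* (fromNat (n !)) (Integrable.isIntegral (binomial[x-t]-integrable x n)))

-- The two sides of a recurrence arise as integrals in different ways; uniqueness of the integral,
-- available because 0 ≤ 1, identifies their values.
integral-cong : ∀ {f g I J} → (∀ t → f t ≈ g t) →
  IsRiemannIntegral 0ℝ 1ℝ f I → IsRiemannIntegral 0ℝ 1ℝ g J → I ≈ J
integral-cong f≈g hf hg =
  isIntegral-unique (fromℚ-mono-≤ (ℚ.nonNegative⁻¹ 1ℚ)) (isIntegral-cong f≈g ≈-refl hf) hg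

theorem3 : ∀ (n : ℕ) (x : ℝ) →
    (cPoly (suc n) x ≈
      - (fromNat n + x) * cPoly n x
        + (- 1ℝ) ^ suc n * fromNat (n !)
          * ∑[ m ≤ n ] (ĉNum (suc (toℕ m)) /! toℕ m
                         * binomial (x + fromNat n) (n ∸ toℕ m)))
    ×
    (ĉPoly (suc n) x ≈
      (x - fromNat n) * ĉPoly n x
        - fromNat (n !)
          * ∑[ m ≤ n ] ((- 1ℝ) ^ toℕ m * cNum (suc (toℕ m)) /! toℕ m
                         * binomial (x - fromNat (toℕ m) - 1ℝ) (n ∸ toℕ m)))
theorem3 n x =
    -- The right side is integrated term by term. At x = 0 the integrand of `ĉPoly` is the falling
    -- factorial of 0 - t, so these terms integrate to the numbers `ĉNum`.
    integral-cong (integrand-recurrence₁ n x) (cPoly-isIntegral (suc n) x)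
      (isIntegral-+
        (isIntegral-* (- (fromNat n + x)) (cPoly-isIntegral n x))
        (isIntegral-* ((- 1ℝ) ^ suc n * fromNat (n !)) (isIntegral-sum {n = n} λ m →
          isIntegral-*ʳ (binomial (x + fromNat n) (n ∸ toℕ m))
            (isIntegral-/! (toℕ m) (ĉPoly-isIntegral (suc (toℕ m)) 0ℝ)))))
  , integral-cong (integrand-recurrence₂ n x) (ĉPoly-isIntegral (suc n) x)
      (isIntegral-+
        (isIntegral-* (x - fromNat n) (ĉPoly-isIntegral n x))
        (isIntegral-neg (isIntegral-* (fromNat (n !)) (isIntegral-sum {n = n} λ m →
          isIntegral-*ʳ (binomial (x - fromNat (toℕ m) - 1ℝ) (n ∸ toℕ m))
            (isIntegral-/! (toℕ m) (isIntegral-* ((- 1ℝ) ^ toℕ m) (cPoly-isIntegral (suc (toℕ m)) 0ℝ)))))))
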